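{- Suppose $f:2^\Omega\to\mathbb{R}_+$ is monotone and submodular. Then for any finite $O\subset\Omega$ and any $A\in\mathbb{R}_+^\Omega$, $$f(O)\le\widehat f(A)+\sum_{v\in O}\widehat f(v|A).$$
   Context: $\Omega$ is a finite ground set. For $A\in\mathbb{R}_+^\Omega$ (identified in the paper with the "valid" subset $\{(u,t):u\in\Omega,\ 0<t\le A_u\}$ of $\Omega\times\mathbb{R}_+$), $\mathsf{R}(A)\subseteq\Omega$ is the random set that includes each $u\in\Omega$ independently with probability $1-e^{ -A_u}$, and $\widehat f(A):=\mathbf{E}[f(\mathsf{R}(A))]$. For $u\in\Omega$, the marginal value is $\widehat f(u|A):=\lim_{t\to0^+}\frac{\widehat f(A\oplus(u,[t]))-\widehat f(A)}{t}$, where $A\oplus(u,[t])$ is the vector obtained from $A$ by increasing coordinate $u$ by $t$. -}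

module Defs where

open import Algebra.Bundles using (CommutativeRing)
import Algebra.Properties.CommutativeSemiring.Exp as Exp
open import Data.Bool.Base using (if_then_else_)
open import Data.Fin.Base using (Fin)
open import Data.Fin.Subset using (Subset; inside; outside; _⊆_; _∪_; _∩_)
open import Data.Fin.Subset.Properties using (_∈?_)
open import Data.Integer.Base as ℤ using ()
import Data.Integer.Properties as ℤ
open import Data.List.Base using (List; []; _∷_; _++_; map; filter; allFin; foldr)
open import Data.Nat.Base as ℕ using (ℕ; zero; suc)
import Data.Nat.Properties as ℕ
open import Data.Product.Base using (∃-syntax; _×_; _,_; proj₁; proj₂)
open import Data.Rational.Base as ℚ using (ℚ; 0ℚ; 1ℚ; mkℚ)
import Data.Rational.Properties as ℚ
import Data.Rational.Unnormalised.Base as ℚᵘ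
import Data.Rational.Unnormalised.Properties as ℚᵘ
open import Data.Rational.Solver using (module +-*-Solver)
open import Data.Sum.Base using (inj₁; inj₂)
open import Data.Vec.Base as Vec using (lookup)
open import Data.Vec.Functional as Vector using (Vector; updateAt)
open import Relation.Binary.PropositionalEquality
  using (_≡_; refl; sym; trans; cong; cong₂; subst)
open import Relation.Nullary.Decidable.Core using (yes; no)
open import Relation.Nullary.Negation.Core using (contradiction)

-- ℝ is built below from Cauchy sequences of rationals. The estimates in this
-- first module serve only to show that the arithmetic operations and exp send
-- Cauchy sequences to Cauchy sequences.

module ℚ^ = Exp (CommutativeRing.commutativeSemiring ℚ.+-*-commutativeRing)

module Estimates where

  open import Data.Rational.Base using (_+_; _*_; _-_; -_; _≤_; _<_; ∣_∣; 1/_; _/_)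
  open +-*-Solver
  open ℚ^ using (_^_)
  open ℚ.≤-Reasoning

  0≤1 : 0ℚ ≤ 1ℚ
  0≤1 = ℚ.nonNegative⁻¹ 1ℚ

  ≤⇒0≤- : ∀ {p q} → p ≤ q → 0ℚ ≤ q - p
  ≤⇒0≤- {p} {q} p≤q = begin
    0ℚ     ≡⟨ ℚ.+-inverseʳ p ⟨
    p - p  ≤⟨ ℚ.+-monoˡ-≤ (- p) p≤q ⟩
    q - p  ∎

  ≤-by : ∀ {p q d} → q ≡ p + d → 0ℚ ≤ d → p ≤ q
  ≤-by {p} {q} {d} q≡p+d 0≤d = begin
    p       ≡⟨ ℚ.+-identityʳ p ⟨
    p + 0ℚ  ≤⟨ ℚ.+-monoʳ-≤ p 0≤d ⟩
    p + d   ≡⟨ q≡p+d ⟨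
    q       ∎

  0≤+ : ∀ {p q} → 0ℚ ≤ p → 0ℚ ≤ q → 0ℚ ≤ p + q
  0≤+ {p} {q} 0≤p 0≤q = begin
    0ℚ       ≡⟨ ℚ.+-identityʳ 0ℚ ⟨
    0ℚ + 0ℚ  ≤⟨ ℚ.+-mono-≤ 0≤p 0≤q ⟩
    p + q    ∎

  *-monoʳ : ∀ {p q r} → 0ℚ ≤ r → p ≤ q → r * p ≤ r * q
  *-monoʳ {r = r} 0≤r = ℚ.*-monoˡ-≤-nonNeg r {{ℚ.nonNegative 0≤r}}

  *-monoˡ : ∀ {p q r} → 0ℚ ≤ r → p ≤ q → p * r ≤ q * r
  *-monoˡ {r = r} 0≤r = ℚ.*-monoʳ-≤-nonNeg r {{ℚ.nonNegative 0≤r}}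

  0≤* : ∀ {p q} → 0ℚ ≤ p → 0ℚ ≤ q → 0ℚ ≤ p * q
  0≤* {p} {q} 0≤p 0≤q = begin
    0ℚ      ≡⟨ ℚ.*-zeroʳ p ⟨
    p * 0ℚ  ≤⟨ *-monoʳ 0≤p 0≤q ⟩
    p * q   ∎

  *-mono : ∀ {p q r s} → 0ℚ ≤ p → 0ℚ ≤ s → p ≤ q → r ≤ s → p * r ≤ q * s
  *-mono 0≤p 0≤s p≤q r≤s = ℚ.≤-trans (*-monoʳ 0≤p r≤s) (*-monoˡ 0≤s p≤q)

  0≤square : ∀ p → 0ℚ ≤ p * p
  0≤square p with ℚ.≤-total 0ℚ p
  ... | inj₁ 0≤p = 0≤* 0≤p 0≤p
  ... | inj₂ p≤0 = subst (0ℚ ≤_)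
    (solve 1 (λ x → (con 0ℚ :- x) :* (con 0ℚ :- x) := x :* x) refl p)
    (0≤* (≤⇒0≤- p≤0) (≤⇒0≤- p≤0))

  ∣∣≤ : ∀ {p c} → p ≤ c → - p ≤ c → ∣ p ∣ ≤ c
  ∣∣≤ {p} p≤c -p≤c with ℚ.∣p∣≡p∨∣p∣≡-p p
  ... | inj₁ eq = subst (_≤ _) (sym eq) p≤c
  ... | inj₂ eq = subst (_≤ _) (sym eq) -p≤c

  p≤∣p∣ : ∀ p → p ≤ ∣ p ∣
  p≤∣p∣ p with ℚ.≤-total 0ℚ p
  ... | inj₁ 0≤p = ℚ.≤-reflexive (sym (ℚ.0≤p⇒∣p∣≡p 0≤p))
  ... | inj₂ p≤0 = ℚ.≤-trans p≤0 (ℚ.0≤∣p∣ p)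

  -p≤∣p∣ : ∀ p → - p ≤ ∣ p ∣
  -p≤∣p∣ p = subst (- p ≤_) (ℚ.∣-p∣≡∣p∣ p) (p≤∣p∣ (- p))

  -∣p∣≤p : ∀ p → - ∣ p ∣ ≤ p
  -∣p∣≤p p = subst (- ∣ p ∣ ≤_) (solve 1 (λ x → :- (:- x) := x) refl p)
    (ℚ.neg-antimono-≤ (-p≤∣p∣ p))

  ∣-∣-comm : ∀ p q → ∣ p - q ∣ ≡ ∣ q - p ∣
  ∣-∣-comm p q = trans (sym (ℚ.∣-p∣≡∣p∣ (p - q)))
    (cong ∣_∣ (solve 2 (λ x y → :- (x :- y) := y :- x) refl p q))

  ∣-∣-triangle : ∀ p q r → ∣ p - r ∣ ≤ ∣ p - q ∣ + ∣ q - r ∣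
  ∣-∣-triangle p q r = begin
    ∣ p - r ∣              ≡⟨ cong ∣_∣ (solve 3 (λ x y z → x :- z := (x :- y) :+ (y :- z)) refl p q r) ⟩
    ∣ (p - q) + (q - r) ∣  ≤⟨ ℚ.∣p+q∣≤∣p∣+∣q∣ (p - q) (q - r) ⟩
    ∣ p - q ∣ + ∣ q - r ∣  ∎

  ∣∣≤∣∣+ : ∀ p q → ∣ p ∣ ≤ ∣ q ∣ + ∣ p - q ∣
  ∣∣≤∣∣+ p q = begin
    ∣ p ∣              ≡⟨ cong ∣_∣ (solve 2 (λ x y → x := y :+ (x :- y)) refl p q) ⟩
    ∣ q + (p - q) ∣    ≤⟨ ℚ.∣p+q∣≤∣p∣+∣q∣ q (p - q) ⟩
    ∣ q ∣ + ∣ p - q ∣  ∎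

  ∣∣∣-∣∣∣≤ : ∀ p q → ∣ ∣ p ∣ - ∣ q ∣ ∣ ≤ ∣ p - q ∣
  ∣∣∣-∣∣∣≤ p q = ∣∣≤ (le p q) (begin
    - (∣ p ∣ - ∣ q ∣)  ≡⟨ solve 2 (λ x y → :- (x :- y) := y :- x) refl ∣ p ∣ ∣ q ∣ ⟩
    ∣ q ∣ - ∣ p ∣      ≤⟨ le q p ⟩
    ∣ q - p ∣          ≡⟨ ∣-∣-comm q p ⟩
    ∣ p - q ∣          ∎)
    where
    le : ∀ p q → ∣ p ∣ - ∣ q ∣ ≤ ∣ p - q ∣
    le p q = begin
      ∣ p ∣ - ∣ q ∣                  ≤⟨ ℚ.+-monoˡ-≤ (- ∣ q ∣) (∣∣≤∣∣+ p q) ⟩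
      (∣ q ∣ + ∣ p - q ∣) - ∣ q ∣    ≡⟨ solve 2 (λ x y → (x :+ y) :- x := y) refl ∣ q ∣ ∣ p - q ∣ ⟩
      ∣ p - q ∣                      ∎

  ι : ℕ → ℚ
  ι k = ℤ.+ k / 1

  r : ℕ → ℚ
  r n = ℤ.+ 1 / suc n

  toℚᵘ-/ : ∀ i d → ℚ.toℚᵘ (i / suc d) ℚᵘ.≃ ℚᵘ.mkℚᵘ i d
  toℚᵘ-/ i d = ℚ.toℚᵘ-fromℚᵘ (ℚᵘ.mkℚᵘ i d)

  ι-+ : ∀ j k → ι (j ℕ.+ k) ≡ ι j + ι k
  ι-+ j k = ℚ.toℚᵘ-injective
    (ℚᵘ.≃-trans (toℚᵘ-/ (ℤ.+ (j ℕ.+ k)) 0)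
    (ℚᵘ.≃-trans (ℚᵘ.*≡* (cong (ℤ._* ℤ.+ 1) (cong₂ ℤ._+_ (sym (ℤ.*-identityʳ (ℤ.+ j))) (sym (ℤ.*-identityʳ (ℤ.+ k))))))
    (ℚᵘ.≃-trans (ℚᵘ.≃-sym (ℚᵘ.+-cong (toℚᵘ-/ (ℤ.+ j) 0) (toℚᵘ-/ (ℤ.+ k) 0)))
    (ℚᵘ.≃-sym (ℚ.toℚᵘ-homo-+ (ι j) (ι k))))))

  ι-suc : ∀ k → ι (suc k) ≡ 1ℚ + ι k
  ι-suc = ι-+ 1

  ι-* : ∀ j k → ι (j ℕ.* k) ≡ ι j * ι k
  ι-* zero    k = sym (ℚ.*-zeroˡ (ι k))
  ι-* (suc j) k = begin-equality
    ι (k ℕ.+ j ℕ.* k)  ≡⟨ ι-+ k (j ℕ.* k) ⟩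
    ι k + ι (j ℕ.* k)  ≡⟨ cong (ι k +_) (ι-* j k) ⟩
    ι k + ι j * ι k    ≡⟨ solve 2 (λ x y → x :+ y :* x := (con 1ℚ :+ y) :* x) refl (ι k) (ι j) ⟩
    (1ℚ + ι j) * ι k   ≡⟨ cong (_* ι k) (ι-suc j) ⟨
    ι (suc j) * ι k    ∎

  0≤ι : ∀ k → 0ℚ ≤ ι k
  0≤ι zero    = ℚ.≤-refl
  0≤ι (suc k) = subst (0ℚ ≤_) (sym (ι-suc k)) (0≤+ 0≤1 (0≤ι k))

  ι-mono : ∀ {j k} → j ℕ.≤ k → ι j ≤ ι k
  ι-mono {j} {k} j≤k = ≤-by
    (trans (cong ι (sym (ℕ.m+[n∸m]≡n j≤k))) (ι-+ j (k ℕ.∸ j)))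
    (0≤ι (k ℕ.∸ j))

  ιr : ∀ n → ι (suc n) * r n ≡ 1ℚ
  ιr n = ℚ.toℚᵘ-injective
    (ℚᵘ.≃-trans (ℚ.toℚᵘ-homo-* (ι (suc n)) (r n))
    (ℚᵘ.≃-trans (ℚᵘ.*-cong (toℚᵘ-/ (ℤ.+ suc n) 0) (toℚᵘ-/ (ℤ.+ 1) n))
    (ℚᵘ.*≡* (trans (ℤ.*-identityʳ _) (trans (ℤ.*-comm (ℤ.+ suc n) (ℤ.+ 1)) (sym (cong (λ k → ℤ.+ 1 ℤ.* (ℤ.+ suc k)) (ℕ.+-identityʳ n))))))))

  0≤r : ∀ n → 0ℚ ≤ r n
  0≤r n = ℚ.nonNegative⁻¹ (r n) {{ℚ.normalize-nonNeg 1 (suc n)}}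

  archimedean : ∀ p → ∃[ b ] p ≤ ι b
  archimedean p@(mkℚ i d _) = ℤ.∣ i ∣ , ℚ.toℚᵘ-cancel-≤
    (ℚᵘ.≤-respʳ-≃ (ℚᵘ.≃-sym (toℚᵘ-/ (ℤ.+ ℤ.∣ i ∣) 0))
      (ℚᵘ.*≤* (subst (ℤ._≤ ℤ.+ ℤ.∣ i ∣ ℤ.* ℤ.+ suc d) (sym (ℤ.*-identityʳ i)) (le i))))
    where
    le : ∀ i → i ℤ.≤ ℤ.+ ℤ.∣ i ∣ ℤ.* ℤ.+ suc d
    le (ℤ.+ n)     = subst (ℤ.+ n ℤ.≤_) (ℤ.pos-* n (suc d)) (ℤ.+≤+ (ℕ.m≤m*n n (suc d)))
    le ℤ.-[1+ n ] = ℤ.-≤+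

  positive-reciprocal : ∀ {p} → 0ℚ < p → ∃[ u ] (0ℚ < u × u * p ≡ 1ℚ)
  positive-reciprocal {p} 0<p =
    1/ p , ℚ.positive⁻¹ (1/ p) {{ℚ.1/pos⇒pos p}} , ℚ.*-inverseˡ p
    where instance
      _ = ℚ.positive 0<p
      _ = ℚ.pos⇒nonZero p

  r-small : ∀ {ε} → 0ℚ < ε → ∃[ k ] (∀ n → k ℕ.≤ n → r n ≤ ε)
  r-small {ε} 0<ε with positive-reciprocal 0<ε
  ... | u , 0<u , uε≡1 with archimedean u
  ... | k , u≤k = k , λ n k≤n → begin
    r n                    ≡⟨ ℚ.*-identityˡ (r n) ⟨
    1ℚ * r n               ≡⟨ cong (_* r n) uε≡1 ⟨
    (u * ε) * r n          ≤⟨ *-monoˡ (0≤r n) (*-monoˡ (ℚ.<⇒≤ 0<ε)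
                                (ℚ.≤-trans u≤k (ι-mono (ℕ.m≤n⇒m≤1+n k≤n)))) ⟩
    (ι (suc n) * ε) * r n  ≡⟨ solve 3 (λ x y z → (x :* y) :* z := (x :* z) :* y) refl (ι (suc n)) ε (r n) ⟩
    (ι (suc n) * r n) * ε  ≡⟨ cong (_* ε) (ιr n) ⟩
    1ℚ * ε                 ≡⟨ ℚ.*-identityˡ ε ⟩
    ε                      ∎

  shrink : ∀ {c ε} → 0ℚ ≤ c → 0ℚ < ε → ∃[ δ ] (0ℚ < δ × c * δ < ε)
  shrink {c} {ε} 0≤c 0<ε with positive-reciprocal 0<1+c
    where
    0<1+c : 0ℚ < 1ℚ + c
    0<1+c = ℚ.<-≤-trans (ℚ.positive⁻¹ 1ℚ) (≤-by refl 0≤c)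
  ... | u , 0<u , u[1+c]≡1 = δ , 0<δ , ℚ.<-respʳ-≡ eq cδ<δ+cδ
    where
    δ = u * ε
    0<δ : 0ℚ < δ
    0<δ = ℚ.positive⁻¹ δ {{ℚ.pos*pos⇒pos u {{ℚ.positive 0<u}} ε {{ℚ.positive 0<ε}}}}
    cδ<δ+cδ : c * δ < δ + c * δ
    cδ<δ+cδ = ℚ.<-respˡ-≡ (ℚ.+-identityˡ (c * δ)) (ℚ.+-monoˡ-< (c * δ) 0<δ)
    eq : δ + c * δ ≡ ε
    eq = trans (solve 3 (λ c u e → u :* e :+ c :* (u :* e) := (u :* (con 1ℚ :+ c)) :* e) refl c u ε)
      (trans (cong (_* ε) u[1+c]≡1) (ℚ.*-identityˡ ε))

  0≤^ : ∀ {p} → 0ℚ ≤ p → ∀ n → 0ℚ ≤ p ^ n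
  0≤^ 0≤p zero    = 0≤1
  0≤^ 0≤p (suc n) = 0≤* 0≤p (0≤^ 0≤p n)

  ^-mono : ∀ {p q} → 0ℚ ≤ p → p ≤ q → ∀ n → p ^ n ≤ q ^ n
  ^-mono 0≤p p≤q zero    = ℚ.≤-refl
  ^-mono 0≤p p≤q (suc n) =
    *-mono 0≤p (0≤^ (ℚ.≤-trans 0≤p p≤q) n) p≤q (^-mono 0≤p p≤q n)

  1≤^ : ∀ {p} → 1ℚ ≤ p → ∀ n → 1ℚ ≤ p ^ n
  1≤^ {p} 1≤p n = subst (_≤ p ^ n) (1^ n) (^-mono 0≤1 1≤p n)
    where
    1^ : ∀ n → 1ℚ ^ n ≡ 1ℚ
    1^ zero    = refl
    1^ (suc n) = trans (ℚ.*-identityˡ (1ℚ ^ n)) (1^ n)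

  ∣^∣ : ∀ p n → ∣ p ^ n ∣ ≡ ∣ p ∣ ^ n
  ∣^∣ p zero    = refl
  ∣^∣ p (suc n) = trans (ℚ.∣p*q∣≡∣p∣*∣q∣ p (p ^ n)) (cong (∣ p ∣ *_) (∣^∣ p n))

  ι-suc-* : ∀ j s → ι (suc j) * s ≡ ι j * s + s
  ι-suc-* j s = trans (cong (_* s) (ι-suc j))
    (solve 2 (λ x y → (con 1ℚ :+ x) :* y := x :* y :+ y) refl (ι j) s)

  bernoulli-lower : ∀ {s} → 0ℚ ≤ 1ℚ + s → ∀ j → 1ℚ + ι j * s ≤ (1ℚ + s) ^ j
  bernoulli-lower {s} 0≤1+s zero =
    ℚ.≤-reflexive (trans (cong (1ℚ +_) (ℚ.*-zeroˡ s)) (ℚ.+-identityʳ 1ℚ))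
  bernoulli-lower {s} 0≤1+s (suc j) = begin
    1ℚ + ι (suc j) * s        ≡⟨ cong (1ℚ +_) (ι-suc-* j s) ⟩
    1ℚ + (ι j * s + s)        ≤⟨ ≤-by
      (solve 2 (λ i s → (con 1ℚ :+ s) :* (con 1ℚ :+ i :* s)
                      := con 1ℚ :+ (i :* s :+ s) :+ i :* (s :* s)) refl (ι j) s)
      (0≤* (0≤ι j) (0≤square s)) ⟩
    (1ℚ + s) * (1ℚ + ι j * s) ≤⟨ *-monoʳ 0≤1+s (bernoulli-lower 0≤1+s j) ⟩
    (1ℚ + s) * (1ℚ + s) ^ j   ∎

  bernoulli-upper : ∀ {s} → 0ℚ ≤ 1ℚ + s → ∀ j → ι j * s ≤ 1ℚ →
    (1ℚ + s) ^ j ≤ 1ℚ + ι j * s + (ι j * s) * (ι j * s)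
  bernoulli-upper {s} 0≤1+s zero js≤1 = ℚ.≤-reflexive
    (solve 1 (λ s → con 1ℚ := con 1ℚ :+ con 0ℚ :* s :+ (con 0ℚ :* s) :* (con 0ℚ :* s)) refl s)
  bernoulli-upper {s} 0≤1+s (suc j) js+s≤1 = begin
    (1ℚ + s) * (1ℚ + s) ^ j        ≤⟨ *-monoʳ 0≤1+s (bernoulli-upper 0≤1+s j js≤1) ⟩
    (1ℚ + s) * (1ℚ + u + u * u)    ≤⟨ ≤-by
      (solve 2 (λ i s → con 1ℚ :+ (i :* s :+ s) :+ (i :* s :+ s) :* (i :* s :+ s)
                      := (con 1ℚ :+ s) :* (con 1ℚ :+ i :* s :+ (i :* s) :* (i :* s))
                         :+ (s :* s) :* (con 1ℚ :+ i :* (con 1ℚ :- i :* s))) refl (ι j) s)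
      (0≤* (0≤square s) (0≤+ 0≤1 (0≤* (0≤ι j) (≤⇒0≤- js≤1)))) ⟩
    1ℚ + (u + s) + (u + s) * (u + s)
      ≡⟨ cong (λ w → 1ℚ + w + w * w) (ι-suc-* j s) ⟨
    1ℚ + ι (suc j) * s + (ι (suc j) * s) * (ι (suc j) * s)  ∎
    where
    u = ι j * s
    js≤1 : ι j * s ≤ 1ℚ
    js≤1 with ℚ.≤-total 0ℚ s
    ... | inj₁ 0≤s = ℚ.≤-trans (≤-by (ι-suc-* j s) 0≤s) js+s≤1
    ... | inj₂ s≤0 = ℚ.≤-trans
      (subst (ι j * s ≤_) (ℚ.*-zeroʳ (ι j)) (*-monoʳ (0≤ι j) s≤0)) 0≤1

  ^-lipschitz : ∀ {p q c} → ∣ p ∣ ≤ c → ∣ q ∣ ≤ c → 1ℚ ≤ c → ∀ n →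
    ∣ p ^ n - q ^ n ∣ ≤ ι n * ∣ p - q ∣ * c ^ n
  ^-lipschitz {p} {q} {c} ∣p∣≤c ∣q∣≤c 1≤c zero = ℚ.≤-reflexive
    (sym (solve 1 (λ x → con 0ℚ :* x :* con 1ℚ := con 0ℚ) refl ∣ p - q ∣))
  ^-lipschitz {p} {q} {c} ∣p∣≤c ∣q∣≤c 1≤c (suc n) = begin
    ∣ p * p ^ n - q * q ^ n ∣
      ≡⟨ cong ∣_∣ (solve 4 (λ p q P Q → p :* P :- q :* Q := p :* (P :- Q) :+ (p :- q) :* Q)
           refl p q (p ^ n) (q ^ n)) ⟩
    ∣ p * (p ^ n - q ^ n) + (p - q) * q ^ n ∣
      ≤⟨ ℚ.∣p+q∣≤∣p∣+∣q∣ (p * (p ^ n - q ^ n)) ((p - q) * q ^ n) ⟩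
    ∣ p * (p ^ n - q ^ n) ∣ + ∣ (p - q) * q ^ n ∣
      ≡⟨ cong₂ _+_ (ℚ.∣p*q∣≡∣p∣*∣q∣ p (p ^ n - q ^ n))
           (trans (ℚ.∣p*q∣≡∣p∣*∣q∣ (p - q) (q ^ n)) (cong (d *_) (∣^∣ q n))) ⟩
    ∣ p ∣ * ∣ p ^ n - q ^ n ∣ + d * ∣ q ∣ ^ n
      ≤⟨ ℚ.+-mono-≤
           (*-mono (ℚ.0≤∣p∣ p) (0≤* (0≤* (0≤ι n) 0≤d) 0≤C) ∣p∣≤c (^-lipschitz ∣p∣≤c ∣q∣≤c 1≤c n))
           (*-monoʳ 0≤d (ℚ.≤-trans (^-mono (ℚ.0≤∣p∣ q) ∣q∣≤c n) C≤cC)) ⟩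
    c * (ι n * d * C) + d * (c * C)
      ≡⟨ solve 4 (λ c i d C → c :* (i :* d :* C) :+ d :* (c :* C) := (con 1ℚ :+ i) :* d :* (c :* C))
           refl c (ι n) d C ⟩
    (1ℚ + ι n) * d * (c * C)
      ≡⟨ cong (λ i → i * d * (c * C)) (ι-suc n) ⟨
    ι (suc n) * d * (c * C) ∎
    where
    d = ∣ p - q ∣
    C = c ^ n
    0≤d = ℚ.0≤∣p∣ (p - q)
    0≤c = ℚ.≤-trans 0≤1 1≤c
    0≤C = 0≤^ 0≤c n
    C≤cC : C ≤ c * C
    C≤cC = subst (_≤ c * C) (ℚ.*-identityˡ C) (*-monoˡ 0≤C 1≤c)

  e : ℚ → ℕ → ℚ
  e q n = (1ℚ + q * r n) ^ suc n

  1≤1+ : ∀ {p} → 0ℚ ≤ p → 1ℚ ≤ 1ℚ + p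
  1≤1+ = ≤-by refl

  ∣1+∣≤ : ∀ {q b} n → ∣ q ∣ ≤ ι b → ∣ 1ℚ + q * r n ∣ ≤ 1ℚ + ι b * r n
  ∣1+∣≤ {q} {b} n ∣q∣≤b = begin
    ∣ 1ℚ + q * r n ∣        ≤⟨ ℚ.∣p+q∣≤∣p∣+∣q∣ 1ℚ (q * r n) ⟩
    1ℚ + ∣ q * r n ∣        ≡⟨ cong (1ℚ +_) (ℚ.∣p*q∣≡∣p∣*∣q∣ q (r n)) ⟩
    1ℚ + ∣ q ∣ * ∣ r n ∣    ≡⟨ cong (λ x → 1ℚ + ∣ q ∣ * x) (ℚ.0≤p⇒∣p∣≡p (0≤r n)) ⟩
    1ℚ + ∣ q ∣ * r n        ≤⟨ ℚ.+-monoʳ-≤ 1ℚ (*-monoˡ (0≤r n) ∣q∣≤b) ⟩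
    1ℚ + ι b * r n          ∎

  e-bound : ∀ b n → e (ι b) n ≤ ι 3 ^ b
  e-bound b n = begin
    (1ℚ + ι b * r n) ^ suc n     ≤⟨ ^-mono (0≤+ 0≤1 (0≤* (0≤ι b) (0≤r n))) (bernoulli-lower 0≤1+r b) (suc n) ⟩
    ((1ℚ + r n) ^ b) ^ suc n     ≡⟨ trans (ℚ^.^-assocʳ (1ℚ + r n) b (suc n))
                                     (trans (ℚ^.^-congʳ (1ℚ + r n) (ℕ.*-comm b (suc n)))
                                            (sym (ℚ^.^-assocʳ (1ℚ + r n) (suc n) b))) ⟩
    ((1ℚ + r n) ^ suc n) ^ b     ≤⟨ ^-mono (0≤^ 0≤1+r (suc n)) ≤3 b ⟩
    ι 3 ^ b                      ∎
    where
    0≤1+r = 0≤+ 0≤1 (0≤r n)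
    ≤3 : (1ℚ + r n) ^ suc n ≤ ι 3
    ≤3 = subst (λ u → (1ℚ + r n) ^ suc n ≤ 1ℚ + u + u * u) (ιr n)
      (bernoulli-upper 0≤1+r (suc n) (ℚ.≤-reflexive (ιr n)))

  e-lipschitz : ∀ {p q b} → ∣ p ∣ ≤ ι b → ∣ q ∣ ≤ ι b → ∀ n →
    ∣ e p n - e q n ∣ ≤ ∣ p - q ∣ * ι 3 ^ b
  e-lipschitz {p} {q} {b} ∣p∣≤b ∣q∣≤b n = begin
    ∣ e p n - e q n ∣
      ≤⟨ ^-lipschitz (∣1+∣≤ {b = b} n ∣p∣≤b) (∣1+∣≤ {b = b} n ∣q∣≤b)
           (1≤1+ (0≤* (0≤ι b) (0≤r n))) (suc n) ⟩
    ι (suc n) * ∣ (1ℚ + p * r n) - (1ℚ + q * r n) ∣ * e (ι b) n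
      ≡⟨ cong (λ x → ι (suc n) * x * e (ι b) n) dist ⟩
    ι (suc n) * (∣ p - q ∣ * r n) * e (ι b) n
      ≡⟨ solve 4 (λ i d s x → i :* (d :* s) :* x := (i :* s) :* d :* x) refl (ι (suc n)) ∣ p - q ∣ (r n) (e (ι b) n) ⟩
    (ι (suc n) * r n) * ∣ p - q ∣ * e (ι b) n
      ≡⟨ cong (_* e (ι b) n) (trans (cong (_* ∣ p - q ∣) (ιr n)) (ℚ.*-identityˡ ∣ p - q ∣)) ⟩
    ∣ p - q ∣ * e (ι b) n
      ≤⟨ *-monoʳ (ℚ.0≤∣p∣ (p - q)) (e-bound b n) ⟩
    ∣ p - q ∣ * ι 3 ^ b ∎
    where
    dist : ∣ (1ℚ + p * r n) - (1ℚ + q * r n) ∣ ≡ ∣ p - q ∣ * r n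
    dist = trans (cong ∣_∣ (solve 3 (λ p q s → (con 1ℚ :+ p :* s) :- (con 1ℚ :+ q :* s) := (p :- q) :* s) refl p q (r n)))
      (trans (ℚ.∣p*q∣≡∣p∣*∣q∣ (p - q) (r n)) (cong (∣ p - q ∣ *_) (ℚ.0≤p⇒∣p∣≡p (0≤r n))))

  -- Approximants of index n and l are compared when 1+l is a multiple of 1+n

  e-refine : ∀ {q b} n m l → suc n ℕ.* suc m ≡ suc l → ∣ q ∣ ≤ ι b → b ℕ.≤ n →
    ∣ e q l - e q n ∣ ≤ ι b * ι b * ι 3 ^ b * r n
  e-refine {q} {b} n m l NM≡L ∣q∣≤b b≤n = begin
    ∣ e q l - e q n ∣
      ≡⟨ cong (λ x → ∣ x - e q n ∣) e≡ ⟩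
    ∣ g ^ suc n - h ^ suc n ∣
      ≤⟨ ^-lipschitz ∣g∣≤c ∣h∣≤c (1≤^ (1≤1+ 0≤bs) (suc m)) (suc n) ⟩
    ι (suc n) * ∣ g - h ∣ * c ^ suc n
      ≤⟨ *-mono (0≤* (0≤ι (suc n)) (ℚ.0≤∣p∣ (g - h))) (0≤^ (0≤ι 3) b)
           (*-monoʳ (0≤ι (suc n)) ∣g-h∣≤) c^≤ ⟩
    ι (suc n) * (ι b * r n * (ι b * r n)) * ι 3 ^ b
      ≡⟨ solve 4 (λ i b s x → i :* (b :* s :* (b :* s)) :* x := (i :* s) :* (b :* b :* x :* s))
           refl (ι (suc n)) (ι b) (r n) (ι 3 ^ b) ⟩
    (ι (suc n) * r n) * (ι b * ι b * ι 3 ^ b * r n)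
      ≡⟨ trans (cong (_* (ι b * ι b * ι 3 ^ b * r n)) (ιr n)) (ℚ.*-identityˡ _) ⟩
    ι b * ι b * ι 3 ^ b * r n ∎
    where
    s = q * r l
    g = (1ℚ + s) ^ suc m
    h = 1ℚ + q * r n
    c = (1ℚ + ι b * r l) ^ suc m

    0≤bs : 0ℚ ≤ ι b * r l
    0≤bs = 0≤* (0≤ι b) (0≤r l)

    rn≡ : r n ≡ ι (suc m) * r l
    rn≡ = begin-equality
      r n                                      ≡⟨ ℚ.*-identityʳ (r n) ⟨
      r n * 1ℚ                                 ≡⟨ cong (r n *_) (ιr l) ⟨
      r n * (ι (suc l) * r l)                  ≡⟨ cong (λ k → r n * (ι k * r l)) NM≡L ⟨
      r n * (ι (suc n ℕ.* suc m) * r l)        ≡⟨ cong (λ x → r n * (x * r l)) (ι-* (suc n) (suc m)) ⟩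
      r n * (ι (suc n) * ι (suc m) * r l)      ≡⟨ solve 4 (λ x i j y → x :* (i :* j :* y) := (i :* x) :* (j :* y))
                                                   refl (r n) (ι (suc n)) (ι (suc m)) (r l) ⟩
      (ι (suc n) * r n) * (ι (suc m) * r l)    ≡⟨ trans (cong (_* (ι (suc m) * r l)) (ιr n)) (ℚ.*-identityˡ _) ⟩
      ι (suc m) * r l                          ∎

    scaled : ∀ x → ι (suc m) * (x * r l) ≡ x * r n
    scaled x = trans (solve 3 (λ i x y → i :* (x :* y) := x :* (i :* y)) refl (ι (suc m)) x (r l))
      (cong (x *_) (sym rn≡))

    e≡ : e q l ≡ g ^ suc n
    e≡ = trans (ℚ^.^-congʳ (1ℚ + s) (trans (sym NM≡L) (ℕ.*-comm (suc n) (suc m))))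
      (sym (ℚ^.^-assocʳ (1ℚ + s) (suc m) (suc n)))

    ∣g∣≤c : ∣ g ∣ ≤ c
    ∣g∣≤c = subst (_≤ c) (sym (∣^∣ (1ℚ + s) (suc m)))
      (^-mono (ℚ.0≤∣p∣ (1ℚ + s)) (∣1+∣≤ {b = b} l ∣q∣≤b) (suc m))

    ∣h∣≤c : ∣ h ∣ ≤ c
    ∣h∣≤c = begin
      ∣ h ∣                             ≤⟨ ∣1+∣≤ {b = b} n ∣q∣≤b ⟩
      1ℚ + ι b * r n                    ≡⟨ cong (1ℚ +_) (scaled (ι b)) ⟨
      1ℚ + ι (suc m) * (ι b * r l)      ≤⟨ bernoulli-lower (0≤+ 0≤1 0≤bs) (suc m) ⟩
      c                                 ∎

    c^≤ : c ^ suc n ≤ ι 3 ^ b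
    c^≤ = subst (_≤ ι 3 ^ b)
      (trans (ℚ^.^-congʳ (1ℚ + ι b * r l) (trans (sym NM≡L) (ℕ.*-comm (suc n) (suc m))))
        (sym (ℚ^.^-assocʳ (1ℚ + ι b * r l) (suc m) (suc n))))
      (e-bound b l)

    b*r≤1 : ∀ k → b ℕ.≤ suc k → ι b * r k ≤ 1ℚ
    b*r≤1 k b≤k = subst (ι b * r k ≤_) (ιr k) (*-monoˡ (0≤r k) (ι-mono b≤k))

    b≤L : b ℕ.≤ suc l
    b≤L = ℕ.≤-trans (ℕ.m≤n⇒m≤1+n b≤n)
      (subst (suc n ℕ.≤_) NM≡L (ℕ.m≤m*n (suc n) (suc m)))

    0≤1+s : 0ℚ ≤ 1ℚ + s
    0≤1+s = begin
      0ℚ                ≤⟨ ≤⇒0≤- (b*r≤1 l b≤L) ⟩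
      1ℚ - ι b * r l    ≡⟨ cong (1ℚ +_) (ℚ.neg-distribˡ-* (ι b) (r l)) ⟩
      1ℚ + - ι b * r l  ≤⟨ ℚ.+-monoʳ-≤ 1ℚ (*-monoˡ (0≤r l)
                            (ℚ.≤-trans (ℚ.neg-antimono-≤ ∣q∣≤b) (-∣p∣≤p q))) ⟩
      1ℚ + s            ∎

    q≤b = ℚ.≤-trans (p≤∣p∣ q) ∣q∣≤b
    Ms≤1 : ι (suc m) * s ≤ 1ℚ
    Ms≤1 = subst (_≤ 1ℚ) (sym (scaled q))
      (ℚ.≤-trans (*-monoˡ (0≤r n) q≤b) (b*r≤1 n (ℕ.m≤n⇒m≤1+n b≤n)))

    h≤g : h ≤ g
    h≤g = subst (λ x → 1ℚ + x ≤ g) (scaled q) (bernoulli-lower 0≤1+s (suc m))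

    square≤ : q * r n * (q * r n) ≤ ι b * r n * (ι b * r n)
    square≤ = begin
      q * r n * (q * r n)                ≡⟨ ℚ.0≤p⇒∣p∣≡p (0≤square (q * r n)) ⟨
      ∣ q * r n * (q * r n) ∣            ≡⟨ ℚ.∣p*q∣≡∣p∣*∣q∣ (q * r n) (q * r n) ⟩
      ∣ q * r n ∣ * ∣ q * r n ∣          ≤⟨ *-mono (ℚ.0≤∣p∣ (q * r n)) (0≤* (0≤ι b) (0≤r n)) ∣qr∣≤ ∣qr∣≤ ⟩
      ι b * r n * (ι b * r n)            ∎
      where
      ∣qr∣≤ : ∣ q * r n ∣ ≤ ι b * r n
      ∣qr∣≤ = begin
        ∣ q * r n ∣        ≡⟨ ℚ.∣p*q∣≡∣p∣*∣q∣ q (r n) ⟩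
        ∣ q ∣ * ∣ r n ∣    ≡⟨ cong (∣ q ∣ *_) (ℚ.0≤p⇒∣p∣≡p (0≤r n)) ⟩
        ∣ q ∣ * r n        ≤⟨ *-monoˡ (0≤r n) ∣q∣≤b ⟩
        ι b * r n          ∎

    ∣g-h∣≤ : ∣ g - h ∣ ≤ ι b * r n * (ι b * r n)
    ∣g-h∣≤ = begin
      ∣ g - h ∣                               ≡⟨ ℚ.0≤p⇒∣p∣≡p (≤⇒0≤- h≤g) ⟩
      g - h                                   ≤⟨ ℚ.+-monoˡ-≤ (- h) (bernoulli-upper 0≤1+s (suc m) Ms≤1) ⟩
      1ℚ + ι (suc m) * s + ι (suc m) * s * (ι (suc m) * s) - h
                                              ≡⟨ cong (λ x → 1ℚ + x + x * x - h) (scaled q) ⟩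
      h + q * r n * (q * r n) - h             ≡⟨ solve 2 (λ h x → h :+ x :- h := x) refl h (q * r n * (q * r n)) ⟩
      q * r n * (q * r n)                     ≤⟨ square≤ ⟩
      ι b * r n * (ι b * r n)                 ∎

  e-dist : ∀ {p q b} m n → ∣ p ∣ ≤ ι b → ∣ q ∣ ≤ ι b → b ℕ.≤ m → b ℕ.≤ n →
    ∣ e p m - e q n ∣ ≤ ∣ p - q ∣ * ι 3 ^ b + (ι b * ι b * ι 3 ^ b * r m + ι b * ι b * ι 3 ^ b * r n)
  e-dist {p} {q} {b} m n ∣p∣≤b ∣q∣≤b b≤m b≤n = begin
    ∣ e p m - e q n ∣
      ≤⟨ ∣-∣-triangle (e p m) (e q m) (e q n) ⟩
    ∣ e p m - e q m ∣ + ∣ e q m - e q n ∣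
      ≤⟨ ℚ.+-mono-≤ (e-lipschitz {b = b} ∣p∣≤b ∣q∣≤b m) (begin
           ∣ e q m - e q n ∣                      ≤⟨ ∣-∣-triangle (e q m) (e q l) (e q n) ⟩
           ∣ e q m - e q l ∣ + ∣ e q l - e q n ∣  ≡⟨ cong (_+ ∣ e q l - e q n ∣) (∣-∣-comm (e q m) (e q l)) ⟩
           ∣ e q l - e q m ∣ + ∣ e q l - e q n ∣  ≤⟨ ℚ.+-mono-≤ (e-refine {b = b} m n l refl ∣q∣≤b b≤m)
                                                      (e-refine {b = b} n m l (ℕ.*-comm (suc n) (suc m)) ∣q∣≤b b≤n) ⟩
           ι b * ι b * ι 3 ^ b * r m + ι b * ι b * ι 3 ^ b * r n ∎) ⟩
    ∣ p - q ∣ * ι 3 ^ b + (ι b * ι b * ι 3 ^ b * r m + ι b * ι b * ι 3 ^ b * r n) ∎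
    where
    l = n ℕ.+ m ℕ.* suc n


Eventually : (ℕ → Set) → Set
Eventually P = ∃[ k ] (∀ n → k ℕ.≤ n → P n)

IsCauchy : (ℕ → ℚ) → Set
IsCauchy s = ∀ ε → 0ℚ ℚ.< ε →
  ∃[ k ] (∀ m n → k ℕ.≤ m → k ℕ.≤ n → ℚ.∣ s m ℚ.- s n ∣ ℚ.< ε)

recip : ℚ → ℚ
recip q with q ℚ.≟ 0ℚ
... | yes _   = 0ℚ
... | no  q≢0 = ℚ.1/_ q {{ℚ.≢-nonZero q≢0}}

module CauchyProofs where

  open Estimates
  open import Data.Rational.Base using (_+_; _*_; _-_; -_; _≤_; _<_; ∣_∣)
  open +-*-Solver
  open ℚ^ using (_^_)
  open ℚ.≤-Reasoning

  ≤⊔ˡ : ∀ {m n o} → m ℕ.⊔ n ℕ.≤ o → m ℕ.≤ o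
  ≤⊔ˡ = ℕ.≤-trans (ℕ.m≤m⊔n _ _)

  ≤⊔ʳ : ∀ {m n o} → m ℕ.⊔ n ℕ.≤ o → n ℕ.≤ o
  ≤⊔ʳ {m} {n} = ℕ.≤-trans (ℕ.m≤n⊔m m n)

  EventuallyWithin : (ℕ → ℚ) → ℚ → Set
  EventuallyWithin s ε =
    ∃[ k ] (∀ m n → k ℕ.≤ m → k ℕ.≤ n → ∣ s m - s n ∣ ≤ ε)

  up-to-constant : ∀ {s} c → 0ℚ ≤ c →
    (∀ δ → 0ℚ < δ → EventuallyWithin s (c * δ)) → IsCauchy s
  up-to-constant c 0≤c h ε 0<ε =
    let δ , 0<δ , cδ<ε = shrink 0≤c 0<ε
        k , bound      = h δ 0<δ
    in k , λ m n k≤m k≤n → ℚ.≤-<-trans (bound m n k≤m k≤n) cδ<ε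

  bounded : ∀ {s} → IsCauchy s → ∃[ b ] Eventually (λ n → ∣ s n ∣ ≤ ι b)
  bounded {s} cs with cs 1ℚ (ℚ.positive⁻¹ 1ℚ)
  ... | k , close with archimedean (∣ s k ∣ + 1ℚ)
  ... | b , ≤b = b , k , λ n k≤n → begin
    ∣ s n ∣                  ≤⟨ ∣∣≤∣∣+ (s n) (s k) ⟩
    ∣ s k ∣ + ∣ s n - s k ∣  ≤⟨ ℚ.+-monoʳ-≤ ∣ s k ∣ (ℚ.<⇒≤ (close n k k≤n ℕ.≤-refl)) ⟩
    ∣ s k ∣ + 1ℚ             ≤⟨ ≤b ⟩
    ι b                      ∎

  const-cauchy : ∀ q → IsCauchy (λ _ → q)
  const-cauchy q ε 0<ε = 0 , λ _ _ _ _ →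
    subst (λ p → ∣ p ∣ < ε) (sym (ℚ.+-inverseʳ q)) 0<ε

  neg-cauchy : ∀ {s} → IsCauchy s → IsCauchy (λ n → - s n)
  neg-cauchy {s} cs ε 0<ε with cs ε 0<ε
  ... | k , close = k , λ m n k≤m k≤n → subst (_< ε)
    (trans (∣-∣-comm (s m) (s n)) (cong ∣_∣
      (solve 2 (λ x y → y :- x := :- x :- :- y) refl (s m) (s n)))) (close m n k≤m k≤n)

  abs-cauchy : ∀ {s} → IsCauchy s → IsCauchy (λ n → ∣ s n ∣)
  abs-cauchy {s} cs ε 0<ε with cs ε 0<ε
  ... | k , close = k , λ m n k≤m k≤n →
    ℚ.≤-<-trans (∣∣∣-∣∣∣≤ (s m) (s n)) (close m n k≤m k≤n)

  +-cauchy : ∀ {s t} → IsCauchy s → IsCauchy t → IsCauchy (λ n → s n + t n)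
  +-cauchy {s} {t} cs ct = up-to-constant {λ n → s n + t n} (1ℚ + 1ℚ) (0≤+ 0≤1 0≤1) bound
    where
    bound : ∀ δ → 0ℚ < δ → EventuallyWithin (λ n → s n + t n) ((1ℚ + 1ℚ) * δ)
    bound δ 0<δ =
      let j , closeˢ = cs δ 0<δ ; k , closeᵗ = ct δ 0<δ in j ℕ.⊔ k , λ m n ≤m ≤n → begin
      ∣ (s m + t m) - (s n + t n) ∣    ≡⟨ cong ∣_∣ (solve 4 (λ a b c d → (a :+ b) :- (c :+ d) := (a :- c) :+ (b :- d))
                                           refl (s m) (t m) (s n) (t n)) ⟩
      ∣ (s m - s n) + (t m - t n) ∣    ≤⟨ ℚ.∣p+q∣≤∣p∣+∣q∣ (s m - s n) (t m - t n) ⟩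
      ∣ s m - s n ∣ + ∣ t m - t n ∣    ≤⟨ ℚ.+-mono-≤ (ℚ.<⇒≤ (closeˢ m n (≤⊔ˡ ≤m) (≤⊔ˡ ≤n)))
                                                    (ℚ.<⇒≤ (closeᵗ m n (≤⊔ʳ ≤m) (≤⊔ʳ ≤n))) ⟩
      δ + δ                            ≡⟨ solve 1 (λ x → x :+ x := (con 1ℚ :+ con 1ℚ) :* x) refl δ ⟩
      (1ℚ + 1ℚ) * δ                          ∎

  *-cauchy : ∀ {s t} → IsCauchy s → IsCauchy t → IsCauchy (λ n → s n * t n)
  *-cauchy {s} {t} cs ct =
    let a , ∣s∣≤a = bounded cs ; b , ∣t∣≤b = bounded ct in *-bounded a b ∣s∣≤a ∣t∣≤b
    where
    *-bounded : ∀ a b → Eventually (λ n → ∣ s n ∣ ≤ ι a) → Eventually (λ n → ∣ t n ∣ ≤ ι b) →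
      IsCauchy (λ n → s n * t n)
    *-bounded a b (i , ∣s∣≤a) (j , ∣t∣≤b) = up-to-constant {λ n → s n * t n} (ι a + ι b) (0≤+ (0≤ι a) (0≤ι b)) bound
      where
      bound : ∀ δ → 0ℚ < δ → EventuallyWithin (λ n → s n * t n) ((ι a + ι b) * δ)
      bound δ 0<δ =
        let k , closeˢ = cs δ 0<δ ; l , closeᵗ = ct δ 0<δ in (i ℕ.⊔ j) ℕ.⊔ (k ℕ.⊔ l) , λ m n ≤m ≤n → begin
        ∣ s m * t m - s n * t n ∣
          ≡⟨ cong ∣_∣ (solve 4 (λ a b c d → a :* b :- c :* d := a :* (b :- d) :+ (a :- c) :* d)
               refl (s m) (t m) (s n) (t n)) ⟩
        ∣ s m * (t m - t n) + (s m - s n) * t n ∣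
          ≤⟨ ℚ.∣p+q∣≤∣p∣+∣q∣ (s m * (t m - t n)) ((s m - s n) * t n) ⟩
        ∣ s m * (t m - t n) ∣ + ∣ (s m - s n) * t n ∣
          ≡⟨ cong₂ _+_ (ℚ.∣p*q∣≡∣p∣*∣q∣ (s m) (t m - t n)) (ℚ.∣p*q∣≡∣p∣*∣q∣ (s m - s n) (t n)) ⟩
        ∣ s m ∣ * ∣ t m - t n ∣ + ∣ s m - s n ∣ * ∣ t n ∣
          ≤⟨ ℚ.+-mono-≤
               (*-mono (ℚ.0≤∣p∣ (s m)) (ℚ.<⇒≤ 0<δ) (∣s∣≤a m (≤⊔ˡ (≤⊔ˡ ≤m)))
                 (ℚ.<⇒≤ (closeᵗ m n (≤⊔ʳ {k} (≤⊔ʳ {i ℕ.⊔ j} ≤m)) (≤⊔ʳ {k} (≤⊔ʳ {i ℕ.⊔ j} ≤n)))))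
               (*-mono (ℚ.0≤∣p∣ (s m - s n)) (0≤ι b)
                 (ℚ.<⇒≤ (closeˢ m n (≤⊔ˡ (≤⊔ʳ {i ℕ.⊔ j} ≤m)) (≤⊔ˡ (≤⊔ʳ {i ℕ.⊔ j} ≤n))))
                 (∣t∣≤b n (≤⊔ʳ {i} (≤⊔ˡ ≤n)))) ⟩
        ι a * δ + δ * ι b
          ≡⟨ solve 3 (λ a b d → a :* d :+ d :* b := (a :+ b) :* d) refl (ι a) (ι b) δ ⟩
        (ι a + ι b) * δ ∎

  recip-* : ∀ {p} → 0ℚ < p → recip p * p ≡ 1ℚ
  recip-* {p} 0<p with p ℚ.≟ 0ℚ
  ... | yes p≡0 = contradiction (sym p≡0) (ℚ.<⇒≢ 0<p)
  ... | no  p≢0 = ℚ.*-inverseˡ p {{ℚ.≢-nonZero p≢0}}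

  0≤recip : ∀ {p} → 0ℚ < p → 0ℚ ≤ recip p
  0≤recip {p} 0<p = begin
    0ℚ                     ≤⟨ ℚ.<⇒≤ 0<u ⟩
    u                      ≡⟨ ℚ.*-identityˡ u ⟨
    1ℚ * u                 ≡⟨ cong (_* u) (recip-* 0<p) ⟨
    (recip p * p) * u      ≡⟨ solve 3 (λ x y z → (x :* y) :* z := x :* (z :* y)) refl (recip p) p u ⟩
    recip p * (u * p)      ≡⟨ trans (cong (recip p *_) up≡1) (ℚ.*-identityʳ (recip p)) ⟩
    recip p                ∎
    where
    u = proj₁ (positive-reciprocal 0<p)
    0<u = proj₁ (proj₂ (positive-reciprocal 0<p))
    up≡1 = proj₂ (proj₂ (positive-reciprocal 0<p))

  recip-anti : ∀ {p q} → 0ℚ < p → p ≤ q → recip q ≤ recip p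
  recip-anti {p} {q} 0<p p≤q = begin
    recip q                    ≡⟨ ℚ.*-identityʳ (recip q) ⟨
    recip q * 1ℚ               ≡⟨ cong (recip q *_) (recip-* 0<p) ⟨
    recip q * (recip p * p)    ≤⟨ *-monoʳ (0≤recip 0<q) (*-monoʳ (0≤recip 0<p) p≤q) ⟩
    recip q * (recip p * q)    ≡⟨ solve 3 (λ x y z → x :* (y :* z) := (x :* z) :* y) refl (recip q) (recip p) q ⟩
    (recip q * q) * recip p    ≡⟨ trans (cong (_* recip p) (recip-* 0<q)) (ℚ.*-identityˡ (recip p)) ⟩
    recip p                    ∎
    where
    0<q = ℚ.<-≤-trans 0<p p≤q

  recip-dist : ∀ {p q ε} → 0ℚ < ε → ε ≤ p → ε ≤ q →
    ∣ recip p - recip q ∣ ≤ recip ε * recip ε * ∣ p - q ∣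
  recip-dist {p} {q} {ε} 0<ε ε≤p ε≤q = begin
    ∣ u - v ∣                  ≡⟨ cong ∣_∣ eq ⟩
    ∣ u * v * (q - p) ∣        ≡⟨ ℚ.∣p*q∣≡∣p∣*∣q∣ (u * v) (q - p) ⟩
    ∣ u * v ∣ * ∣ q - p ∣      ≡⟨ cong₂ _*_ (ℚ.0≤p⇒∣p∣≡p (0≤* 0≤u 0≤v)) (∣-∣-comm q p) ⟩
    u * v * ∣ p - q ∣          ≤⟨ *-monoˡ (ℚ.0≤∣p∣ (p - q))
                                   (*-mono 0≤u (0≤recip 0<ε) (recip-anti 0<ε ε≤p) (recip-anti 0<ε ε≤q)) ⟩
    recip ε * recip ε * ∣ p - q ∣  ∎
    where
    u = recip p
    v = recip q
    0<p = ℚ.<-≤-trans 0<ε ε≤p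
    0<q = ℚ.<-≤-trans 0<ε ε≤q
    0≤u = 0≤recip 0<p
    0≤v = 0≤recip 0<q
    eq : u - v ≡ u * v * (q - p)
    eq = sym (begin-equality
      u * v * (q - p)              ≡⟨ solve 4 (λ u v p q → u :* v :* (q :- p) := u :* (v :* q) :- v :* (u :* p)) refl u v p q ⟩
      u * (v * q) - v * (u * p)    ≡⟨ cong₂ (λ x y → u * x - v * y) (recip-* 0<q) (recip-* 0<p) ⟩
      u * 1ℚ - v * 1ℚ              ≡⟨ cong₂ _-_ (ℚ.*-identityʳ u) (ℚ.*-identityʳ v) ⟩
      u - v                        ∎)

  recip-cauchy : ∀ {s ε} → 0ℚ < ε → Eventually (λ n → ε ≤ s n) → IsCauchy s →
    IsCauchy (λ n → recip (s n))
  recip-cauchy {s} {ε} 0<ε (j , ε≤s) cs = up-to-constant {λ n → recip (s n)} (recip ε * recip ε) 0≤c bound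
    where
    0≤c = 0≤* (0≤recip 0<ε) (0≤recip 0<ε)
    bound : ∀ δ → 0ℚ < δ → EventuallyWithin (λ n → recip (s n)) (recip ε * recip ε * δ)
    bound δ 0<δ with cs δ 0<δ
    ... | k , close = j ℕ.⊔ k , λ m n ≤m ≤n → ℚ.≤-trans
      (recip-dist 0<ε (ε≤s m (≤⊔ˡ ≤m)) (ε≤s n (≤⊔ˡ ≤n)))
      (*-monoʳ 0≤c (ℚ.<⇒≤ (close m n (≤⊔ʳ ≤m) (≤⊔ʳ ≤n))))

  exp-cauchy : ∀ {s} → IsCauchy s → IsCauchy (λ n → e (s n) n)
  exp-cauchy {s} cs = let b , ∣s∣≤b = bounded cs in exp-bounded b ∣s∣≤b
    where
    exp-bounded : ∀ b → Eventually (λ n → ∣ s n ∣ ≤ ι b) → IsCauchy (λ n → e (s n) n)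
    exp-bounded b (i , ∣s∣≤b) = up-to-constant {λ n → e (s n) n} (c + (d + d)) (0≤+ 0≤c (0≤+ 0≤d 0≤d)) bound
      where
      c = ι 3 ^ b
      d = ι b * ι b * c
      0≤c = 0≤^ (0≤ι 3) b
      0≤d = 0≤* (0≤* (0≤ι b) (0≤ι b)) 0≤c
      bound : ∀ δ → 0ℚ < δ → EventuallyWithin (λ n → e (s n) n) ((c + (d + d)) * δ)
      bound δ 0<δ = let j , close = cs δ 0<δ ; k , r≤δ = r-small 0<δ in (i ℕ.⊔ b) ℕ.⊔ (j ℕ.⊔ k) , λ m n ≤m ≤n → begin
        ∣ e (s m) m - e (s n) n ∣
          ≤⟨ e-dist {b = b} m n (∣s∣≤b m (≤⊔ˡ (≤⊔ˡ ≤m))) (∣s∣≤b n (≤⊔ˡ (≤⊔ˡ ≤n)))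
               (≤⊔ʳ {i} (≤⊔ˡ ≤m)) (≤⊔ʳ {i} (≤⊔ˡ ≤n)) ⟩
        ∣ s m - s n ∣ * c + (d * r m + d * r n)
          ≤⟨ ℚ.+-mono-≤
               (*-monoˡ 0≤c (ℚ.<⇒≤ (close m n (≤⊔ˡ (≤⊔ʳ {i ℕ.⊔ b} ≤m)) (≤⊔ˡ (≤⊔ʳ {i ℕ.⊔ b} ≤n)))))
               (ℚ.+-mono-≤ (*-monoʳ 0≤d (r≤δ m (≤⊔ʳ {j} (≤⊔ʳ {i ℕ.⊔ b} ≤m))))
                           (*-monoʳ 0≤d (r≤δ n (≤⊔ʳ {j} (≤⊔ʳ {i ℕ.⊔ b} ≤n))))) ⟩
        δ * c + (d * δ + d * δ)
          ≡⟨ solve 3 (λ c d x → x :* c :+ (d :* x :+ d :* x) := (c :+ (d :+ d)) :* x) refl c d δ ⟩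
        (c + (d + d)) * δ ∎

open CauchyProofs

-- No quotient is taken: two sequences represent the same real number when
-- x ≤ y and y ≤ x in the order below.

record ℝ : Set where
  constructor mkℝ
  field
    seq    : ℕ → ℚ
    cauchy : IsCauchy seq

open ℝ public

infix 4 _≤_ _<_

_≤_ : ℝ → ℝ → Set
x ≤ y = ∀ ε → 0ℚ ℚ.< ε → Eventually (λ n → seq x n ℚ.≤ seq y n ℚ.+ ε)

_<_ : ℝ → ℝ → Set
x < y = ∃[ ε ] (0ℚ ℚ.< ε × Eventually (λ n → seq x n ℚ.+ ε ℚ.≤ seq y n))

infix  8 -_
infixl 7 _*_
infixl 6 _+_ _-_

fromℚ : ℚ → ℝ
fromℚ q = mkℝ (λ _ → q) (const-cauchy q)

0ℝ 1ℝ : ℝ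
0ℝ = fromℚ 0ℚ
1ℝ = fromℚ 1ℚ

-_ : ℝ → ℝ
- x = mkℝ (λ n → ℚ.- seq x n) (neg-cauchy {seq x} (cauchy x))

∣_∣ : ℝ → ℝ
∣ x ∣ = mkℝ (λ n → ℚ.∣ seq x n ∣) (abs-cauchy {seq x} (cauchy x))

_+_ _*_ _-_ : ℝ → ℝ → ℝ
x + y = mkℝ (λ n → seq x n ℚ.+ seq y n) (+-cauchy {seq x} {seq y} (cauchy x) (cauchy y))
x * y = mkℝ (λ n → seq x n ℚ.* seq y n) (*-cauchy {seq x} {seq y} (cauchy x) (cauchy y))
x - y = x + - y

_÷_⟨_⟩ : ℝ → (y : ℝ) → 0ℝ < y → ℝ
x ÷ y ⟨ ε , 0<ε , k , 0+ε≤y ⟩ = x * mkℝ (λ n → recip (seq y n))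
  (recip-cauchy {seq y} 0<ε (k , λ n k≤n → subst (ℚ._≤ seq y n) (ℚ.+-identityˡ ε) (0+ε≤y n k≤n)) (cauchy y))

-- eˣ as the limit of (1 + x/n)ⁿ, taken along the diagonal: the n-th
-- approximant of x is used with exponent n + 1. The diagonal has the same
-- limit because q ↦ (1 + q/n)ⁿ is Lipschitz on bounded sets uniformly in n
-- (e-lipschitz).

exp : ℝ → ℝ
exp x = mkℝ (λ n → (1ℚ ℚ.+ seq x n ℚ.* (ℤ.+ 1 ℚ./ suc n)) ℚ^.^ suc n)
  (exp-cauchy {seq x} (cauchy x))

-- g(t) → l as t → 0⁺; g is only given on positive t

IsRightLimitAt0 : ((t : ℝ) → 0ℝ < t → ℝ) → ℝ → Set
IsRightLimitAt0 g l = ∀ ε → 0ℝ < ε → ∃[ δ ] (0ℝ < δ ×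
  (∀ t (0<t : 0ℝ < t) → t < δ → ∣ g t 0<t - l ∣ < ε))

∑ : ∀ {X : Set} → List X → (X → ℝ) → ℝ
∑ xs g = foldr _+_ 0ℝ (map g xs)

∏ : ∀ {n} → Vector ℝ n → ℝ
∏ = Vector.foldr _*_ 1ℝ

-- The ground set Ω is Fin n.

elements : ∀ {n} → Subset n → List (Fin n)
elements S = filter (_∈? S) (allFin _)

subsets : ∀ n → List (Subset n)
subsets zero    = Vec.[] ∷ []
subsets (suc n) = map (inside Vec.∷_) (subsets n) ++ map (outside Vec.∷_) (subsets n)

Monotone : ∀ {n} → (Subset n → ℝ) → Set
Monotone f = ∀ S T → S ⊆ T → f S ≤ f T

Submodular : ∀ {n} → (Subset n → ℝ) → Set
Submodular f = ∀ S T → f (S ∪ T) + f (S ∩ T) ≤ f S + f T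

-- The law of the random set R(A) that contains each u independently with
-- probability 1 - e^(-A u)

ℙ[R_≡_] : ∀ {n} → Vector ℝ n → Subset n → ℝ
ℙ[R A ≡ S ] = ∏ (λ u → if lookup S u then 1ℝ - exp (- A u) else exp (- A u))

-- 𝔼 f A is the expectation of f(R(A)).

𝔼 : ∀ {n} → (Subset n → ℝ) → Vector ℝ n → ℝ
𝔼 f A = ∑ (subsets _) (λ S → ℙ[R A ≡ S ] * f S)

_⊕[_,_] : ∀ {n} → Vector ℝ n → Fin n → ℝ → Vector ℝ n
A ⊕[ u , t ] = updateAt A u (_+ t)

-- IsMarginal f A u m: the limit defining the marginal value of u at A exists
-- and equals m.

IsMarginal : ∀ {n} → (Subset n → ℝ) → Vector ℝ n → Fin n → ℝ → Set
IsMarginal f A u = IsRightLimitAt0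
  (λ t 0<t → (𝔼 f (A ⊕[ u , t ]) - 𝔼 f A) ÷ t ⟨ 0<t ⟩)

{-# OPTIONS --safe #-}
module Submission where

-- Let q u = e^(-A u), the probability that u is missing from R = R(A). The
-- expectation of f(R) is multilinear in the q u, and its slope in q u is
-- - D u, where D u is the mean influence 𝔼[f(R with u) - f(R without u)],
-- which does not depend on q u. Hence (𝔼-increment)
--
--   𝔼 f (A ⊕[ u , t ]) - 𝔼 f A = (e^(-A u) - e^(-(A u + t))) D u.
--
-- Since e^(-a) - e^(-(a+t)) = e^(-a) t + O(t²) (exp-increment), dividing by t
-- shows that the marginal value exists and equals q u D u (isMarginal).
-- Adding u changes R only if u is missing from R, and this event is
-- independent of the other elements, so q u D u is also the expectation of
-- f(R with u) - f(R) (𝔼-gain).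
--
-- For a fixed set S, monotonicity and submodularity give
--
--   f O ≤ f S + Σ_{v ∈ O} (f(S with v) - f S)        (≤-sum-of-gains),
--
-- by adjoining the elements of O to S one after the other: the gain from
-- adjoining v to a larger set is at most the gain from adjoining it to S.
-- Taking expectations over S = R(A) gives the theorem. This preserves the
-- inequality because the probabilities are nonnegative (0≤ℙ, 𝔼-mono).
--
-- A real number is a Cauchy sequence of rationals and the operations act
-- termwise, so every identity between expectations is proved exactly, at each
-- index, as an identity between rational expectations (mean). Limits occur
-- only in the order on the reals, in the properties of exp, and in the
-- differentiation.

open import Defs
open import Data.Nat.Base using (ℕ)
open import Data.Fin.Base using (Fin)
open import Data.Fin.Subset using (Subset)
open import Data.Vec.Functional using (Vector)
open import Data.Product.Base using (Σ-syntax; _×_)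

open import Data.Bool.Base using (if_then_else_)
open import Data.Bool.Properties using (if-float)
open import Data.Fin.Base using (zero; suc)
open import Data.Fin.Properties using (_≟_)
open import Data.Fin.Subset using (Side; inside; outside; _∈_; _⊆_; _∪_; _∩_)
open import Data.Fin.Subset.Properties using (_∈?_; x∈p∪q⁺; x∈p∩q⁺)
open import Data.List.Base using (List; []; _∷_; _++_; foldr; map)
open import Data.List.Membership.Propositional using () renaming (_∈_ to _∈ˡ_)
open import Data.List.Membership.Propositional.Properties using (∈-filter⁺; ∈-allFin)
open import Data.List.Properties using (map-∘; map-cong)
open import Data.List.Relation.Unary.Any using (here; there)
import Data.Nat.Base as ℕ
import Data.Nat.Properties as ℕ
open import Data.Product.Base using (∃-syntax; _,_; proj₁; proj₂)
open import Data.Rational.Base as ℚ using (ℚ; 0ℚ; 1ℚ)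
import Data.Rational.Properties as ℚ
open import Data.Rational.Solver using (module +-*-Solver)
open import Data.Sum.Base using (inj₁; inj₂)
open import Data.Vec.Base as Vec using (_[_]≔_)
open import Data.Vec.Functional as Vector using (head; tail; updateAt)
open import Data.Vec.Properties
  using ([]≔-updates; []≔-minimal; []=⇒lookup; lookup⇒[]=; lookup∘update′)
open import Function.Base using (_∘_)
open import Relation.Binary.Bundles using (Preorder)
open import Relation.Binary.PropositionalEquality
  using (_≡_; _≢_; refl; sym; trans; cong; cong₂; subst; module ≡-Reasoning)
import Relation.Binary.Reasoning.Preorder as PreorderReasoning
open import Relation.Nullary.Decidable.Core using (yes; no)

open Estimates
open CauchyProofs using (≤⊔ˡ; ≤⊔ʳ; bounded; recip-*; 0≤recip; recip-anti)
open +-*-Solver using (solve; _:=_; _:+_; _:*_; _:-_; :-_; con)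

private variable
  X : Set

-- Eventual bounds on sequences

eventually₂ : ∀ {P Q R : ℕ → Set} → Eventually P → Eventually Q →
  (∀ n → P n → Q n → R n) → Eventually R
eventually₂ (j , p) (k , q) h =
  j ℕ.⊔ k , λ n ≤n → h n (p n (≤⊔ˡ ≤n)) (q n (≤⊔ʳ {j} ≤n))

-- These existence statements are abstract so that the numbers they provide
-- are never computed.
abstract

  shrink-≤1 : ∀ {c ε} → 0ℚ ℚ.≤ c → 0ℚ ℚ.< ε →
    ∃[ δ ] (0ℚ ℚ.< δ × δ ℚ.≤ 1ℚ × c ℚ.* δ ℚ.≤ ε)
  shrink-≤1 {c} {ε} 0≤c 0<ε = let δ , 0<δ , cδ<ε = shrink 0≤c 0<ε in cap δ 0<δ (ℚ.<⇒≤ cδ<ε)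
    where
    cap : ∀ δ → 0ℚ ℚ.< δ → c ℚ.* δ ℚ.≤ ε → ∃[ δ ] (0ℚ ℚ.< δ × δ ℚ.≤ 1ℚ × c ℚ.* δ ℚ.≤ ε)
    cap δ 0<δ cδ≤ε with ℚ.≤-total δ 1ℚ
    ... | inj₁ δ≤1 = δ , 0<δ , δ≤1 , cδ≤ε
    ... | inj₂ 1≤δ = 1ℚ , ℚ.positive⁻¹ 1ℚ , ℚ.≤-refl , ℚ.≤-trans (*-monoʳ 0≤c 1≤δ) cδ≤ε

  halve : ∀ {ε} → 0ℚ ℚ.< ε → ∃[ δ ] (0ℚ ℚ.< δ × δ ℚ.+ δ ℚ.≤ ε)
  halve {ε} 0<ε =
    let δ , 0<δ , _ , 2δ≤ε = shrink-≤1 {1ℚ ℚ.+ 1ℚ} (0≤+ 0≤1 0≤1) 0<ε in δ , 0<δ , δ+δ≤ δ 2δ≤ε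
    where
    δ+δ≤ : ∀ δ → (1ℚ ℚ.+ 1ℚ) ℚ.* δ ℚ.≤ ε → δ ℚ.+ δ ℚ.≤ ε
    δ+δ≤ δ = ℚ.≤-trans (ℚ.≤-reflexive
      (solve 1 (λ x → x :+ x := (con 1ℚ :+ con 1ℚ) :* x) refl δ))

  eventually-bounded : ∀ x → ∃[ b ] Eventually (λ n → ℚ.∣ seq x n ∣ ℚ.≤ ι b)
  eventually-bounded x = bounded {seq x} (cauchy x)

-- Termwise equality and the ordered ring of real numbers

-- The representing sequences agree at every index. Ring identities hold in
-- this strict sense, and it implies x ≤ y and y ≤ x.

record _≐_ (x y : ℝ) : Set where
  constructor termwise
  field at : ∀ n → seq x n ≡ seq y n

open _≐_
infix 4 _≐_

≐-refl : ∀ {x} → x ≐ x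
≐-refl .at n = refl

≐-sym : ∀ {x y} → x ≐ y → y ≐ x
≐-sym x≐y .at n = sym (at x≐y n)

≐-trans : ∀ {x y z} → x ≐ y → y ≐ z → x ≐ z
≐-trans x≐y y≐z .at n = trans (at x≐y n) (at y≐z n)

≐⇒≤ : ∀ {x y} → x ≐ y → x ≤ y
≐⇒≤ x≐y ε 0<ε = 0 , λ n _ → ≤-by (cong (ℚ._+ ε) (sym (at x≐y n))) (ℚ.<⇒≤ 0<ε)

≤-refl : ∀ x → x ≤ x
≤-refl x = ≐⇒≤ (≐-refl {x})

≤-trans : ∀ x y z → x ≤ y → y ≤ z → x ≤ z
≤-trans x y z x≤y y≤z ε 0<ε =
  let δ , 0<δ , 2δ≤ε = halve 0<ε
  in eventually₂ (x≤y δ 0<δ) (y≤z δ 0<δ) λ n p q → begin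
       seq x n                     ≤⟨ p ⟩
       seq y n ℚ.+ δ               ≤⟨ ℚ.+-monoˡ-≤ δ q ⟩
       seq z n ℚ.+ δ ℚ.+ δ         ≡⟨ ℚ.+-assoc (seq z n) δ δ ⟩
       seq z n ℚ.+ (δ ℚ.+ δ)       ≤⟨ ℚ.+-monoʳ-≤ (seq z n) 2δ≤ε ⟩
       seq z n ℚ.+ ε               ∎
  where open ℚ.≤-Reasoning

≤-preorder : Preorder _ _ _
≤-preorder = record
  { Carrier    = ℝ
  ; _≈_        = _≐_
  ; _≲_        = _≤_
  ; isPreorder = record
    { isEquivalence = record { refl = ≐-refl ; sym = ≐-sym ; trans = ≐-trans }
    ; reflexive     = ≐⇒≤
    ; trans         = λ {x} {y} {z} → ≤-trans x y z
    }
  }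

module ≤-Reasoning = PreorderReasoning ≤-preorder

+-mono-≤ : ∀ x y u v → x ≤ y → u ≤ v → x + u ≤ y + v
+-mono-≤ x y u v x≤y u≤v ε 0<ε =
  let δ , 0<δ , 2δ≤ε = halve 0<ε
  in eventually₂ (x≤y δ 0<δ) (u≤v δ 0<δ) λ n p q → begin
       seq x n ℚ.+ seq u n                    ≤⟨ ℚ.+-mono-≤ p q ⟩
       seq y n ℚ.+ δ ℚ.+ (seq v n ℚ.+ δ)      ≡⟨ solve 3 (λ a b d → a :+ d :+ (b :+ d) := a :+ b :+ (d :+ d)) refl (seq y n) (seq v n) δ ⟩
       seq y n ℚ.+ seq v n ℚ.+ (δ ℚ.+ δ)      ≤⟨ ℚ.+-monoʳ-≤ (seq y n ℚ.+ seq v n) 2δ≤ε ⟩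
       seq y n ℚ.+ seq v n ℚ.+ ε              ∎
  where open ℚ.≤-Reasoning

+-cancelʳ-≤ : ∀ x y z → x + z ≤ y + z → x ≤ y
+-cancelʳ-≤ x y z x+z≤y+z = begin
  x              ≈⟨ cancel x ⟩
  (x + z) - z    ≲⟨ +-mono-≤ (x + z) (y + z) (- z) (- z) x+z≤y+z (≤-refl (- z)) ⟩
  (y + z) - z    ≈⟨ cancel y ⟨
  y              ∎
  where
  open ≤-Reasoning
  cancel : ∀ w → w ≐ (w + z) - z
  cancel w .at n = solve 2 (λ a b → a := a :+ b :- b) refl (seq w n) (seq z n)

-- x y ≥ - (|x| + |y| + δ) δ whenever x and y are at least -δ.
0≤x*y : ∀ x y → 0ℝ ≤ x → 0ℝ ≤ y → 0ℝ ≤ x * y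
0≤x*y x y 0≤x 0≤y ε 0<ε =
  let a , ∣x∣≤a = eventually-bounded x
      b , ∣y∣≤b = eventually-bounded y
      c = ι a ℚ.+ ι b ℚ.+ 1ℚ
      δ , 0<δ , δ≤1 , cδ≤ε = shrink-≤1 {c} (0≤+ (0≤+ (0≤ι a) (0≤ι b)) 0≤1) 0<ε
  in eventually₂ (eventually₂ ∣x∣≤a ∣y∣≤b λ _ → _,_) (eventually₂ (0≤x δ 0<δ) (0≤y δ 0<δ) λ _ → _,_)
       λ { n (x≤a , y≤b) (0≤x+δ , 0≤y+δ) → let p = seq x n ; q = seq y n in begin
       0ℚ                                  ≤⟨ 0≤* 0≤x+δ 0≤y+δ ⟩
       (p ℚ.+ δ) ℚ.* (q ℚ.+ δ)             ≡⟨ solve 3 (λ p q d → (p :+ d) :* (q :+ d) := p :* q :+ (p :+ q :+ d) :* d) refl p q δ ⟩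
       p ℚ.* q ℚ.+ (p ℚ.+ q ℚ.+ δ) ℚ.* δ   ≤⟨ ℚ.+-monoʳ-≤ (p ℚ.* q) (*-monoˡ (ℚ.<⇒≤ 0<δ)
                                               (ℚ.+-mono-≤ (ℚ.+-mono-≤ (ℚ.≤-trans (p≤∣p∣ p) x≤a) (ℚ.≤-trans (p≤∣p∣ q) y≤b)) δ≤1)) ⟩
       p ℚ.* q ℚ.+ c ℚ.* δ                 ≤⟨ ℚ.+-monoʳ-≤ (p ℚ.* q) cδ≤ε ⟩
       p ℚ.* q ℚ.+ ε                       ∎ }
  where open ℚ.≤-Reasoning

x≤y⇒0≤y-x : ∀ x y → x ≤ y → 0ℝ ≤ y - x
x≤y⇒0≤y-x x y x≤y = begin
  0ℝ      ≈⟨ inverse ⟩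
  x - x   ≲⟨ +-mono-≤ x y (- x) (- x) x≤y (≤-refl (- x)) ⟩
  y - x   ∎
  where
  open ≤-Reasoning
  inverse : 0ℝ ≐ x - x
  inverse .at n = sym (ℚ.+-inverseʳ (seq x n))

*-monoʳ-≤ : ∀ x y z → 0ℝ ≤ x → y ≤ z → x * y ≤ x * z
*-monoʳ-≤ x y z 0≤x y≤z = begin
  x * y                  ≈⟨ identity ⟩
  0ℝ + x * y             ≲⟨ +-mono-≤ 0ℝ (x * (z - y)) (x * y) (x * y)
                              (0≤x*y x (z - y) 0≤x (x≤y⇒0≤y-x y z y≤z)) (≤-refl (x * y)) ⟩
  x * (z - y) + x * y    ≈⟨ distrib ⟩
  x * z                  ∎
  where
  open ≤-Reasoning
  identity : x * y ≐ 0ℝ + x * y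
  identity .at n = sym (ℚ.+-identityˡ (seq (x * y) n))
  distrib : x * (z - y) + x * y ≐ x * z
  distrib .at n = solve 3 (λ a b c → a :* (c :- b) :+ a :* b := a :* c) refl (seq x n) (seq y n) (seq z n)

-- The exponential function

-- For b ≤ n the base 1 + q / (n + 1) of the n-th approximant of e^q is
-- nonnegative.
0≤base : ∀ {q b} n → ℚ.∣ q ∣ ℚ.≤ ι b → b ℕ.≤ n → 0ℚ ℚ.≤ 1ℚ ℚ.+ q ℚ.* r n
0≤base {q} {b} n ∣q∣≤b b≤n = begin
  0ℚ                        ≤⟨ ≤⇒0≤- br≤1 ⟩
  1ℚ ℚ.- ι b ℚ.* r n        ≡⟨ cong (1ℚ ℚ.+_) (ℚ.neg-distribˡ-* (ι b) (r n)) ⟩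
  1ℚ ℚ.+ ℚ.- ι b ℚ.* r n    ≤⟨ ℚ.+-monoʳ-≤ 1ℚ (*-monoˡ (0≤r n)
                                 (ℚ.≤-trans (ℚ.neg-antimono-≤ ∣q∣≤b) (-∣p∣≤p q))) ⟩
  1ℚ ℚ.+ q ℚ.* r n          ∎
  where
  open ℚ.≤-Reasoning
  br≤1 : ι b ℚ.* r n ℚ.≤ 1ℚ
  br≤1 = subst (ι b ℚ.* r n ℚ.≤_) (ιr n) (*-monoˡ (0≤r n) (ι-mono (ℕ.m≤n⇒m≤1+n b≤n)))

eventually-0≤base : ∀ x → Eventually (λ n → 0ℚ ℚ.≤ 1ℚ ℚ.+ seq x n ℚ.* r n)
eventually-0≤base x =
  let b , ∣x∣≤b = eventually-bounded x
  in eventually₂ ∣x∣≤b (b , λ _ b≤n → b≤n) λ n → 0≤base n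

0≤exp : ∀ x → 0ℝ ≤ exp x
0≤exp x ε 0<ε =
  let k , 0≤1+xr = eventually-0≤base x
  in k , λ n k≤n → 0≤+ (0≤^ (0≤1+xr n k≤n) (ℕ.suc n)) (ℚ.<⇒≤ 0<ε)

ι*[q*r] : ∀ q n → ι (ℕ.suc n) ℚ.* (q ℚ.* r n) ≡ q
ι*[q*r] q n = trans (solve 3 (λ i q s → i :* (q :* s) := (i :* s) :* q) refl (ι (ℕ.suc n)) q (r n))
  (trans (cong (ℚ._* q) (ιr n)) (ℚ.*-identityˡ q))

e-lower : ∀ {q} n → 0ℚ ℚ.≤ 1ℚ ℚ.+ q ℚ.* r n → 1ℚ ℚ.+ q ℚ.≤ e q n
e-lower {q} n 0≤1+qr = subst (λ u → 1ℚ ℚ.+ u ℚ.≤ e q n) (ι*[q*r] q n)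
  (bernoulli-lower 0≤1+qr (ℕ.suc n))

e-upper : ∀ {q} n → 0ℚ ℚ.≤ 1ℚ ℚ.+ q ℚ.* r n → q ℚ.≤ 1ℚ → e q n ℚ.≤ 1ℚ ℚ.+ q ℚ.+ q ℚ.* q
e-upper {q} n 0≤1+qr q≤1 = subst (λ u → e q n ℚ.≤ 1ℚ ℚ.+ u ℚ.+ u ℚ.* u) (ι*[q*r] q n)
  (bernoulli-upper 0≤1+qr (ℕ.suc n) (subst (ℚ._≤ 1ℚ) (sym (ι*[q*r] q n)) q≤1))

-- If x ≥ -δ, then e^(-x) ≤ e^δ ≤ 1 + δ + δ² ≤ 1 + 2δ for δ ≤ 1.
exp[-x]≤1 : ∀ x → 0ℝ ≤ x → exp (- x) ≤ 1ℝ
exp[-x]≤1 x 0≤x ε 0<ε =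
  let δ , 0<δ , δ≤1 , 2δ≤ε = shrink-≤1 {1ℚ ℚ.+ 1ℚ} (0≤+ 0≤1 0≤1) 0<ε
      0≤δ = ℚ.<⇒≤ 0<δ
  in eventually₂ (eventually-0≤base (- x)) (0≤x δ 0<δ) λ n 0≤1-xr 0≤x+δ → begin
       e (ℚ.- seq x n) n              ≤⟨ ^-mono 0≤1-xr (ℚ.+-monoʳ-≤ 1ℚ (*-monoˡ {ℚ.- seq x n} {δ} (0≤r n)
                                           (≤-by (solve 2 (λ d y → d := :- y :+ (y :+ d)) refl δ (seq x n)) 0≤x+δ))) (ℕ.suc n) ⟩
       e δ n                          ≤⟨ e-upper n (0≤+ 0≤1 (0≤* 0≤δ (0≤r n))) δ≤1 ⟩
       1ℚ ℚ.+ δ ℚ.+ δ ℚ.* δ           ≤⟨ ℚ.+-monoʳ-≤ (1ℚ ℚ.+ δ) (*-monoʳ 0≤δ δ≤1) ⟩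
       1ℚ ℚ.+ δ ℚ.+ δ ℚ.* 1ℚ          ≡⟨ solve 1 (λ d → con 1ℚ :+ d :+ d :* con 1ℚ := con 1ℚ :+ (con 1ℚ :+ con 1ℚ) :* d) refl δ ⟩
       1ℚ ℚ.+ (1ℚ ℚ.+ 1ℚ) ℚ.* δ       ≤⟨ ℚ.+-monoʳ-≤ 1ℚ 2δ≤ε ⟩
       1ℚ ℚ.+ ε                       ∎
  where open ℚ.≤-Reasoning

-- The bases of the two sides differ by p q / (n + 1)², and raising them to
-- the power n + 1 multiplies this by at most (n + 1) times a constant.
e-+ : ∀ {p q a b} n → ℚ.∣ p ∣ ℚ.≤ ι a → ℚ.∣ q ∣ ℚ.≤ ι b →
  ℚ.∣ e p n ℚ.* e q n ℚ.- e (p ℚ.+ q) n ∣ ℚ.≤ ι a ℚ.* ι b ℚ.* (ι 3 ℚ^.^ a ℚ.* ι 3 ℚ^.^ b) ℚ.* r n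
e-+ {p} {q} {a} {b} n ∣p∣≤a ∣q∣≤b = begin
  ℚ.∣ e p n ℚ.* e q n ℚ.- e (p ℚ.+ q) n ∣
    ≡⟨ cong (λ u → ℚ.∣ u ℚ.- e (p ℚ.+ q) n ∣) (ℚ^.^-distrib-* (1ℚ ℚ.+ p ℚ.* s) (1ℚ ℚ.+ q ℚ.* s) (ℕ.suc n)) ⟨
  ℚ.∣ g ℚ^.^ ℕ.suc n ℚ.- h ℚ^.^ ℕ.suc n ∣
    ≤⟨ ^-lipschitz ∣g∣≤c ∣h∣≤c 1≤c (ℕ.suc n) ⟩
  ι (ℕ.suc n) ℚ.* ℚ.∣ g ℚ.- h ∣ ℚ.* c ℚ^.^ ℕ.suc n
    ≤⟨ *-mono (0≤* (0≤ι (ℕ.suc n)) (ℚ.0≤∣p∣ (g ℚ.- h))) (0≤* (0≤^ (0≤ι 3) a) (0≤^ (0≤ι 3) b))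
         (*-monoʳ (0≤ι (ℕ.suc n)) ∣g-h∣≤) c^≤ ⟩
  ι (ℕ.suc n) ℚ.* (ι a ℚ.* ι b ℚ.* (s ℚ.* s)) ℚ.* C
    ≡⟨ solve 5 (λ i a b s C → i :* (a :* b :* (s :* s)) :* C := (i :* s) :* (a :* b :* C :* s))
         refl (ι (ℕ.suc n)) (ι a) (ι b) s C ⟩
  (ι (ℕ.suc n) ℚ.* s) ℚ.* (ι a ℚ.* ι b ℚ.* C ℚ.* s)
    ≡⟨ trans (cong (ℚ._* (ι a ℚ.* ι b ℚ.* C ℚ.* s)) (ιr n)) (ℚ.*-identityˡ _) ⟩
  ι a ℚ.* ι b ℚ.* C ℚ.* s ∎
  where
  open ℚ.≤-Reasoning
  s = r n
  g = (1ℚ ℚ.+ p ℚ.* s) ℚ.* (1ℚ ℚ.+ q ℚ.* s)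
  h = 1ℚ ℚ.+ (p ℚ.+ q) ℚ.* s
  c = (1ℚ ℚ.+ ι a ℚ.* s) ℚ.* (1ℚ ℚ.+ ι b ℚ.* s)
  C = ι 3 ℚ^.^ a ℚ.* ι 3 ℚ^.^ b

  0≤as : 0ℚ ℚ.≤ ι a ℚ.* s
  0≤as = 0≤* (0≤ι a) (0≤r n)
  0≤bs : 0ℚ ℚ.≤ ι b ℚ.* s
  0≤bs = 0≤* (0≤ι b) (0≤r n)

  1+≤c : 1ℚ ℚ.+ (ι a ℚ.+ ι b) ℚ.* s ℚ.≤ c
  1+≤c = ≤-by (solve 3 (λ a b s → (con 1ℚ :+ a :* s) :* (con 1ℚ :+ b :* s)
                        := con 1ℚ :+ (a :+ b) :* s :+ (a :* s) :* (b :* s)) refl (ι a) (ι b) s)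
    (0≤* 0≤as 0≤bs)

  1≤c : 1ℚ ℚ.≤ c
  1≤c = ℚ.≤-trans (1≤1+ (0≤* (0≤+ (0≤ι a) (0≤ι b)) (0≤r n))) 1+≤c

  ∣g∣≤c : ℚ.∣ g ∣ ℚ.≤ c
  ∣g∣≤c = subst (ℚ._≤ c) (sym (ℚ.∣p*q∣≡∣p∣*∣q∣ (1ℚ ℚ.+ p ℚ.* s) (1ℚ ℚ.+ q ℚ.* s)))
    (*-mono (ℚ.0≤∣p∣ (1ℚ ℚ.+ p ℚ.* s)) (0≤+ 0≤1 0≤bs) (∣1+∣≤ {b = a} n ∣p∣≤a) (∣1+∣≤ {b = b} n ∣q∣≤b))

  ∣h∣≤c : ℚ.∣ h ∣ ℚ.≤ c
  ∣h∣≤c = begin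
    ℚ.∣ h ∣                          ≤⟨ ∣1+∣≤ {p ℚ.+ q} {a ℕ.+ b} n (begin
      ℚ.∣ p ℚ.+ q ∣                    ≤⟨ ℚ.∣p+q∣≤∣p∣+∣q∣ p q ⟩
      ℚ.∣ p ∣ ℚ.+ ℚ.∣ q ∣              ≤⟨ ℚ.+-mono-≤ ∣p∣≤a ∣q∣≤b ⟩
      ι a ℚ.+ ι b                      ≡⟨ ι-+ a b ⟨
      ι (a ℕ.+ b)                      ∎) ⟩
    1ℚ ℚ.+ ι (a ℕ.+ b) ℚ.* s         ≡⟨ cong (λ u → 1ℚ ℚ.+ u ℚ.* s) (ι-+ a b) ⟩
    1ℚ ℚ.+ (ι a ℚ.+ ι b) ℚ.* s       ≤⟨ 1+≤c ⟩
    c                                ∎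

  ∣g-h∣≤ : ℚ.∣ g ℚ.- h ∣ ℚ.≤ ι a ℚ.* ι b ℚ.* (s ℚ.* s)
  ∣g-h∣≤ = begin
    ℚ.∣ g ℚ.- h ∣                          ≡⟨ cong ℚ.∣_∣ (solve 3 (λ p q s →
      (con 1ℚ :+ p :* s) :* (con 1ℚ :+ q :* s) :- (con 1ℚ :+ (p :+ q) :* s) := p :* q :* (s :* s)) refl p q s) ⟩
    ℚ.∣ p ℚ.* q ℚ.* (s ℚ.* s) ∣            ≡⟨ ℚ.∣p*q∣≡∣p∣*∣q∣ (p ℚ.* q) (s ℚ.* s) ⟩
    ℚ.∣ p ℚ.* q ∣ ℚ.* ℚ.∣ s ℚ.* s ∣        ≡⟨ cong₂ ℚ._*_ (ℚ.∣p*q∣≡∣p∣*∣q∣ p q) (ℚ.0≤p⇒∣p∣≡p (0≤square s)) ⟩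
    ℚ.∣ p ∣ ℚ.* ℚ.∣ q ∣ ℚ.* (s ℚ.* s)      ≤⟨ *-monoˡ (0≤square s) (*-mono (ℚ.0≤∣p∣ p) (0≤ι b) ∣p∣≤a ∣q∣≤b) ⟩
    ι a ℚ.* ι b ℚ.* (s ℚ.* s)              ∎

  c^≤ : c ℚ^.^ ℕ.suc n ℚ.≤ C
  c^≤ = begin
    c ℚ^.^ ℕ.suc n              ≡⟨ ℚ^.^-distrib-* (1ℚ ℚ.+ ι a ℚ.* s) (1ℚ ℚ.+ ι b ℚ.* s) (ℕ.suc n) ⟩
    e (ι a) n ℚ.* e (ι b) n     ≤⟨ *-mono (0≤^ (0≤+ 0≤1 0≤as) (ℕ.suc n)) (0≤^ (0≤ι 3) b) (e-bound a n) (e-bound b n) ⟩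
    C                           ∎

-- e^x * e^y and e^(x+y) have the same limit.
exp-+ : ∀ x y ε → 0ℚ ℚ.< ε →
  Eventually (λ n → ℚ.∣ seq (exp x * exp y) n ℚ.- seq (exp (x + y)) n ∣ ℚ.≤ ε)
exp-+ x y ε 0<ε =
  let a , ∣x∣≤a = eventually-bounded x
      b , ∣y∣≤b = eventually-bounded y
      0≤c = 0≤* (0≤* (0≤ι a) (0≤ι b)) (0≤* (0≤^ (0≤ι 3) a) (0≤^ (0≤ι 3) b))
      δ , 0<δ , _ , cδ≤ε = shrink-≤1 0≤c 0<ε
  in eventually₂ (eventually₂ ∣x∣≤a ∣y∣≤b λ _ → _,_) (r-small 0<δ) λ { n (x≤a , y≤b) r≤δ →
       ℚ.≤-trans (e-+ {a = a} {b = b} n x≤a y≤b) (ℚ.≤-trans (*-monoʳ 0≤c r≤δ) cδ≤ε) }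

-- 1 - t ≤ e^(-t) ≤ 1 - t + t², by bernoulli-lower and bernoulli-upper.
exp[-t]-linear : ∀ t → 0ℝ < t → t < 1ℝ →
  Eventually (λ n → ℚ.∣ 1ℚ ℚ.- seq t n ℚ.- seq (exp (- t)) n ∣ ℚ.≤ seq t n ℚ.* seq t n)
exp[-t]-linear t (ε , 0<ε , 0+ε≤t) (η , 0<η , t+η≤1) =
  eventually₂ (eventually-0≤base (- t)) (eventually₂ 0+ε≤t t+η≤1 λ _ → _,_) λ { n 0≤1-tr (0+ε≤t , t+η≤1) →
    bound n (ℚ.≤-trans (0≤+ {0ℚ} {ε} ℚ.≤-refl (ℚ.<⇒≤ 0<ε)) 0+ε≤t) 0≤1-tr }
  where
  open ℚ.≤-Reasoning
  bound : ∀ {p} n → 0ℚ ℚ.≤ p → 0ℚ ℚ.≤ 1ℚ ℚ.+ ℚ.- p ℚ.* r n →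
    ℚ.∣ 1ℚ ℚ.- p ℚ.- e (ℚ.- p) n ∣ ℚ.≤ p ℚ.* p
  bound {p} n 0≤p 0≤1-pr = ∣∣≤
    (begin
      1ℚ ℚ.- p ℚ.- T                ≤⟨ ℚ.+-monoˡ-≤ (ℚ.- T) (e-lower {ℚ.- p} n 0≤1-pr) ⟩
      T ℚ.- T                       ≡⟨ ℚ.+-inverseʳ T ⟩
      0ℚ                            ≤⟨ 0≤square p ⟩
      p ℚ.* p                       ∎)
    (begin
      ℚ.- (1ℚ ℚ.- p ℚ.- T)          ≡⟨ solve 2 (λ p T → :- (con 1ℚ :- p :- T) := T :- (con 1ℚ :- p)) refl p T ⟩
      T ℚ.- (1ℚ ℚ.- p)              ≤⟨ ℚ.+-monoˡ-≤ (ℚ.- (1ℚ ℚ.- p)) (e-upper {ℚ.- p} n 0≤1-pr -p≤1) ⟩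
      1ℚ ℚ.+ ℚ.- p ℚ.+ ℚ.- p ℚ.* ℚ.- p ℚ.- (1ℚ ℚ.- p)
                                    ≡⟨ solve 1 (λ p → con 1ℚ :+ :- p :+ :- p :* :- p :- (con 1ℚ :- p) := p :* p) refl p ⟩
      p ℚ.* p                       ∎)
    where
    T = e (ℚ.- p) n
    -p≤1 : ℚ.- p ℚ.≤ 1ℚ
    -p≤1 = ℚ.≤-trans (ℚ.neg-antimono-≤ 0≤p) 0≤1

-- (e^(-a) - e^(-(a+t))) d = (e^(-a) d) t + O(t²) for 0 < t < 1: in view of
-- e^(-(a+t)) = e^(-a) e^(-t), the error is e^(-a) d (1 - t - e^(-t)).
exp-increment : ∀ a d → ∃[ c ] (0ℚ ℚ.≤ c × (∀ t → 0ℝ < t → t < 1ℝ →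
  ∣ (exp (- a) - exp (- (a + t))) * d - (exp (- a) * d) * t ∣ ≤ fromℚ c * (t * t)))
exp-increment a d =
  let β , ∣E∣≤β = eventually-bounded (exp (- a))
      γ , ∣d∣≤γ = eventually-bounded d
  in ι β ℚ.* ι γ , 0≤* (0≤ι β) (0≤ι γ) , λ t 0<t t<1 ε 0<ε →
  let η , 0<η , _ , γη≤ε = shrink-≤1 {ι γ} (0≤ι γ) 0<ε
  in eventually₂ (eventually₂ ∣E∣≤β ∣d∣≤γ λ _ → _,_)
          (eventually₂ (exp-+ (- a) (- t) η 0<η) (exp[-t]-linear t 0<t t<1) λ _ → _,_)
     λ { n (E≤β , d≤γ) (ET-X≤η , 1-t-T≤) → ℚ.≤-trans
       (estimate (seq d n) (seq t n) (ι β) (ι γ) (0≤ι β) (0≤ι γ)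
         E≤β d≤γ
         (subst (λ p → ℚ.∣ seq (exp (- a)) n ℚ.* seq (exp (- t)) n ℚ.- e p n ∣ ℚ.≤ η)
           (sym (ℚ.neg-distrib-+ (seq a n) (seq t n))) ET-X≤η)
         1-t-T≤)
       (ℚ.+-monoʳ-≤ (ι β ℚ.* ι γ ℚ.* (seq t n ℚ.* seq t n)) γη≤ε) }
  where
  open ℚ.≤-Reasoning
  estimate : ∀ {E T X η} d t β γ → 0ℚ ℚ.≤ β → 0ℚ ℚ.≤ γ → ℚ.∣ E ∣ ℚ.≤ β → ℚ.∣ d ∣ ℚ.≤ γ →
    ℚ.∣ E ℚ.* T ℚ.- X ∣ ℚ.≤ η → ℚ.∣ 1ℚ ℚ.- t ℚ.- T ∣ ℚ.≤ t ℚ.* t →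
    ℚ.∣ (E ℚ.- X) ℚ.* d ℚ.- E ℚ.* d ℚ.* t ∣ ℚ.≤ β ℚ.* γ ℚ.* (t ℚ.* t) ℚ.+ γ ℚ.* η
  estimate {E} {T} {X} {η} d t β γ 0≤β 0≤γ E≤β d≤γ ET-X≤η 1-t-T≤ = begin
    ℚ.∣ (E ℚ.- X) ℚ.* d ℚ.- E ℚ.* d ℚ.* t ∣
      ≡⟨ cong ℚ.∣_∣ (solve 5 (λ E X T d t → (E :- X) :* d :- E :* d :* t
           := E :* d :* (con 1ℚ :- t :- T) :+ d :* (E :* T :- X)) refl E X T d t) ⟩
    ℚ.∣ E ℚ.* d ℚ.* u ℚ.+ d ℚ.* v ∣
      ≤⟨ ℚ.∣p+q∣≤∣p∣+∣q∣ (E ℚ.* d ℚ.* u) (d ℚ.* v) ⟩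
    ℚ.∣ E ℚ.* d ℚ.* u ∣ ℚ.+ ℚ.∣ d ℚ.* v ∣
      ≡⟨ cong₂ ℚ._+_ (trans (ℚ.∣p*q∣≡∣p∣*∣q∣ (E ℚ.* d) u) (cong (ℚ._* ℚ.∣ u ∣) (ℚ.∣p*q∣≡∣p∣*∣q∣ E d)))
           (ℚ.∣p*q∣≡∣p∣*∣q∣ d v) ⟩
    ℚ.∣ E ∣ ℚ.* ℚ.∣ d ∣ ℚ.* ℚ.∣ u ∣ ℚ.+ ℚ.∣ d ∣ ℚ.* ℚ.∣ v ∣
      ≤⟨ ℚ.+-mono-≤
           (*-mono (0≤* (ℚ.0≤∣p∣ E) (ℚ.0≤∣p∣ d)) (0≤square t) (*-mono (ℚ.0≤∣p∣ E) 0≤γ E≤β d≤γ) 1-t-T≤)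
           (*-mono (ℚ.0≤∣p∣ d) (ℚ.≤-trans (ℚ.0≤∣p∣ v) ET-X≤η) d≤γ ET-X≤η) ⟩
    β ℚ.* γ ℚ.* (t ℚ.* t) ℚ.+ γ ℚ.* η ∎
    where
    u = 1ℚ ℚ.- t ℚ.- T
    v = E ℚ.* T ℚ.- X

-- If g t = l t + O(t²), then g t / t tends to l as t → 0⁺.
quotient-limit : (g : ℝ → ℝ) (l : ℝ) (c : ℚ) → 0ℚ ℚ.≤ c →
  (∀ t → 0ℝ < t → t < 1ℝ → ∣ g t - l * t ∣ ≤ fromℚ c * (t * t)) →
  IsRightLimitAt0 (λ t 0<t → g t ÷ t ⟨ 0<t ⟩) l
quotient-limit g l c 0≤c ∣g-lt∣≤ct² ε (ε₀ , 0<ε₀ , 0+ε₀≤ε) =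
  -- The three parts ρ of ε pay for c t, for the slack η in the hypothesis on
  -- g after division by t ≥ τ, and for the strictness of the inequality.
  let ρ , 0<ρ , _ , 3ρ≤ε₀ = shrink-≤1 {1ℚ ℚ.+ 1ℚ ℚ.+ 1ℚ} (0≤+ (0≤+ 0≤1 0≤1) 0≤1) 0<ε₀
      δ , 0<δ , δ≤1 , cδ≤ρ = shrink-≤1 0≤c 0<ρ
  in fromℚ δ , (δ , 0<δ , 0 , λ _ _ → ℚ.≤-reflexive (ℚ.+-identityˡ δ)) ,
  λ { t 0<t@(τ , 0<τ , 0+τ≤t) (σ , 0<σ , t+σ≤δ) →
  let t<1 = σ , 0<σ , proj₁ t+σ≤δ , λ n k≤n → ℚ.≤-trans (proj₂ t+σ≤δ n k≤n) δ≤1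
      0≤1/τ = 0≤recip 0<τ
      η , 0<η , _ , η/τ≤ρ = shrink-≤1 0≤1/τ 0<ρ
  in ρ , 0<ρ , eventually₂ (eventually₂ 0+τ≤t t+σ≤δ λ _ → _,_)
                    (eventually₂ (∣g-lt∣≤ct² t 0<t t<1 η 0<η) 0+ε₀≤ε λ _ → _,_)
     λ { n (0+τ≤t , t+σ≤δ) (g-lt≤ , 0+ε₀≤ε) →
       let τ≤t = subst (ℚ._≤ seq t n) (ℚ.+-identityˡ τ) 0+τ≤t
           0<tₙ = ℚ.<-≤-trans 0<τ τ≤t
       in estimate (seq (g t) n) (seq l n) (seq t n) (recip (seq t n))
         (0≤recip 0<tₙ) (recip-* 0<tₙ)
         (ℚ.≤-trans (*-monoʳ 0≤c (ℚ.≤-trans (≤-by refl (ℚ.<⇒≤ 0<σ)) t+σ≤δ)) cδ≤ρ)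
         (ℚ.≤-trans (*-monoˡ (ℚ.<⇒≤ 0<η) (recip-anti 0<τ τ≤t)) η/τ≤ρ)
         g-lt≤
         (ℚ.≤-trans 3ρ≤ε₀ (subst (ℚ._≤ seq ε n) (ℚ.+-identityˡ ε₀) 0+ε₀≤ε)) } }
  where
  open ℚ.≤-Reasoning
  estimate : ∀ y l t u {ρ η ε} → 0ℚ ℚ.≤ u → u ℚ.* t ≡ 1ℚ → c ℚ.* t ℚ.≤ ρ → u ℚ.* η ℚ.≤ ρ →
    ℚ.∣ y ℚ.- l ℚ.* t ∣ ℚ.≤ c ℚ.* (t ℚ.* t) ℚ.+ η →
    (1ℚ ℚ.+ 1ℚ ℚ.+ 1ℚ) ℚ.* ρ ℚ.≤ ε → ℚ.∣ y ℚ.* u ℚ.- l ∣ ℚ.+ ρ ℚ.≤ ε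
  estimate y l t u {ρ} {η} {ε} 0≤u ut≡1 ct≤ρ uη≤ρ ≤ct²+η 3ρ≤ε = begin
    ℚ.∣ y ℚ.* u ℚ.- l ∣ ℚ.+ ρ
      ≡⟨ cong (λ x → ℚ.∣ x ∣ ℚ.+ ρ) yu-l≡ ⟩
    ℚ.∣ u ℚ.* (y ℚ.- l ℚ.* t) ∣ ℚ.+ ρ
      ≡⟨ cong (ℚ._+ ρ) (trans (ℚ.∣p*q∣≡∣p∣*∣q∣ u (y ℚ.- l ℚ.* t)) (cong (ℚ._* ℚ.∣ y ℚ.- l ℚ.* t ∣) (ℚ.0≤p⇒∣p∣≡p 0≤u))) ⟩
    u ℚ.* ℚ.∣ y ℚ.- l ℚ.* t ∣ ℚ.+ ρ
      ≤⟨ ℚ.+-monoˡ-≤ ρ (*-monoʳ 0≤u ≤ct²+η) ⟩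
    u ℚ.* (c ℚ.* (t ℚ.* t) ℚ.+ η) ℚ.+ ρ
      ≡⟨ cong (ℚ._+ ρ) (solve 4 (λ u c t η → u :* (c :* (t :* t) :+ η) := c :* ((u :* t) :* t) :+ u :* η) refl u c t η) ⟩
    c ℚ.* ((u ℚ.* t) ℚ.* t) ℚ.+ u ℚ.* η ℚ.+ ρ
      ≡⟨ cong (λ x → c ℚ.* x ℚ.+ u ℚ.* η ℚ.+ ρ) (trans (cong (ℚ._* t) ut≡1) (ℚ.*-identityˡ t)) ⟩
    c ℚ.* t ℚ.+ u ℚ.* η ℚ.+ ρ
      ≤⟨ ℚ.+-monoˡ-≤ ρ (ℚ.+-mono-≤ ct≤ρ uη≤ρ) ⟩
    ρ ℚ.+ ρ ℚ.+ ρ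
      ≡⟨ solve 1 (λ x → x :+ x :+ x := (con 1ℚ :+ con 1ℚ :+ con 1ℚ) :* x) refl ρ ⟩
    (1ℚ ℚ.+ 1ℚ ℚ.+ 1ℚ) ℚ.* ρ
      ≤⟨ 3ρ≤ε ⟩
    ε ∎
    where
    yu-l≡ : y ℚ.* u ℚ.- l ≡ u ℚ.* (y ℚ.- l ℚ.* t)
    yu-l≡ = begin-equality
      y ℚ.* u ℚ.- l                  ≡⟨ cong (λ x → y ℚ.* u ℚ.- x) (ℚ.*-identityʳ l) ⟨
      y ℚ.* u ℚ.- l ℚ.* 1ℚ           ≡⟨ cong (λ x → y ℚ.* u ℚ.- l ℚ.* x) ut≡1 ⟨
      y ℚ.* u ℚ.- l ℚ.* (u ℚ.* t)    ≡⟨ solve 4 (λ y u l t → y :* u :- l :* (u :* t) := u :* (y :- l :* t)) refl y u l t ⟩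
      u ℚ.* (y ℚ.- l ℚ.* t)          ∎

-- Rational expectations

-- The expectation of F(R) when R omits each u independently with
-- probability q u, by conditioning on the elements one after the other.
-- The q u are arbitrary rationals, since the approximants of a probability
-- need not lie between 0 and 1.

mean : ∀ {n} → Vector ℚ n → (Subset n → ℚ) → ℚ
mean {ℕ.zero}  q F = F Vec.[]
mean {ℕ.suc n} q F = (1ℚ ℚ.- head q) ℚ.* mean (tail q) (F ∘ (inside Vec.∷_))
                     ℚ.+ head q ℚ.* mean (tail q) (F ∘ (outside Vec.∷_))

mean-cong : ∀ {n} {q q′ : Vector ℚ n} {F G} → (∀ u → q u ≡ q′ u) → (∀ S → F S ≡ G S) →
  mean q F ≡ mean q′ G
mean-cong {ℕ.zero}  q≗q′ F≗G = F≗G Vec.[]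
mean-cong {ℕ.suc n} q≗q′ F≗G = cong₂ ℚ._+_
  (cong₂ (λ p x → (1ℚ ℚ.- p) ℚ.* x) (q≗q′ zero) (mean-cong (q≗q′ ∘ suc) (F≗G ∘ (inside Vec.∷_))))
  (cong₂ ℚ._*_ (q≗q′ zero) (mean-cong (q≗q′ ∘ suc) (F≗G ∘ (outside Vec.∷_))))

mean-const : ∀ {n} (q : Vector ℚ n) c → mean q (λ _ → c) ≡ c
mean-const {ℕ.zero}  q c = refl
mean-const {ℕ.suc n} q c = trans
  (cong (λ x → (1ℚ ℚ.- head q) ℚ.* x ℚ.+ head q ℚ.* x) (mean-const (tail q) c))
  (solve 2 (λ q c → (con 1ℚ :- q) :* c :+ q :* c := c) refl (head q) c)

mean-+ : ∀ {n} (q : Vector ℚ n) F G → mean q (λ S → F S ℚ.+ G S) ≡ mean q F ℚ.+ mean q G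
mean-+ {ℕ.zero}  q F G = refl
mean-+ {ℕ.suc n} q F G = trans
  (cong₂ (λ x y → (1ℚ ℚ.- head q) ℚ.* x ℚ.+ head q ℚ.* y)
    (mean-+ (tail q) (F ∘ (inside Vec.∷_)) (G ∘ (inside Vec.∷_)))
    (mean-+ (tail q) (F ∘ (outside Vec.∷_)) (G ∘ (outside Vec.∷_))))
  (solve 5 (λ q x y u v → (con 1ℚ :- q) :* (x :+ u) :+ q :* (y :+ v)
      := (con 1ℚ :- q) :* x :+ q :* y :+ ((con 1ℚ :- q) :* u :+ q :* v)) refl
    (head q) (mean (tail q) (F ∘ (inside Vec.∷_))) (mean (tail q) (F ∘ (outside Vec.∷_)))
    (mean (tail q) (G ∘ (inside Vec.∷_))) (mean (tail q) (G ∘ (outside Vec.∷_))))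

mean-- : ∀ {n} (q : Vector ℚ n) F G → mean q (λ S → F S ℚ.- G S) ≡ mean q F ℚ.- mean q G
mean-- q F G = begin
  F-G                                  ≡⟨ solve 2 (λ x y → x := x :+ y :- y) refl F-G (mean q G) ⟩
  F-G ℚ.+ mean q G ℚ.- mean q G        ≡⟨ cong (ℚ._- mean q G) (mean-+ q (λ S → F S ℚ.- G S) G) ⟨
  mean q (λ S → F S ℚ.- G S ℚ.+ G S) ℚ.- mean q G
    ≡⟨ cong (ℚ._- mean q G) (mean-cong (λ _ → refl) λ S → solve 2 (λ x y → x :- y :+ y := x) refl (F S) (G S)) ⟩
  mean q F ℚ.- mean q G                ∎
  where
  open ≡-Reasoning
  F-G = mean q (λ S → F S ℚ.- G S)

-- The influence of u compares S with u to S without u; the gain of u compares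
-- S with u to S.
influenceℚ gainℚ : ∀ {n} → (Subset n → ℚ) → Fin n → Subset n → ℚ
influenceℚ F u S = F (S [ u ]≔ inside) ℚ.- F (S [ u ]≔ outside)
gainℚ      F u S = F (S [ u ]≔ inside) ℚ.- F S

-- The mean is affine in q u with slope minus the mean influence of u.
mean-update : ∀ {n} (q : Vector ℚ n) F u p →
  mean (updateAt q u (λ _ → p)) F ℚ.- mean q F ≡ (q u ℚ.- p) ℚ.* mean q (influenceℚ F u)
mean-update {ℕ.suc n} q F zero p = begin
  (1ℚ ℚ.- p) ℚ.* x ℚ.+ p ℚ.* y ℚ.- ((1ℚ ℚ.- head q) ℚ.* x ℚ.+ head q ℚ.* y)
    ≡⟨ solve 4 (λ p q x y → (con 1ℚ :- p) :* x :+ p :* y :- ((con 1ℚ :- q) :* x :+ q :* y)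
         := (q :- p) :* ((con 1ℚ :- q) :* (x :- y) :+ q :* (x :- y))) refl p (head q) x y ⟩
  (head q ℚ.- p) ℚ.* ((1ℚ ℚ.- head q) ℚ.* (x ℚ.- y) ℚ.+ head q ℚ.* (x ℚ.- y))
    ≡⟨ cong (λ z → (head q ℚ.- p) ℚ.* ((1ℚ ℚ.- head q) ℚ.* z ℚ.+ head q ℚ.* z))
         (mean-- (tail q) (F ∘ (inside Vec.∷_)) (F ∘ (outside Vec.∷_))) ⟨
  (head q ℚ.- p) ℚ.* mean q (influenceℚ F zero) ∎
  where
  open ≡-Reasoning
  x = mean (tail q) (F ∘ (inside Vec.∷_))
  y = mean (tail q) (F ∘ (outside Vec.∷_))
mean-update {ℕ.suc n} q F (suc u) p = begin
  (1ℚ ℚ.- head q) ℚ.* x′ ℚ.+ head q ℚ.* y′ ℚ.- ((1ℚ ℚ.- head q) ℚ.* x ℚ.+ head q ℚ.* y)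
    ≡⟨ solve 5 (λ q x y x′ y′ → (con 1ℚ :- q) :* x′ :+ q :* y′ :- ((con 1ℚ :- q) :* x :+ q :* y)
         := (con 1ℚ :- q) :* (x′ :- x) :+ q :* (y′ :- y)) refl (head q) x y x′ y′ ⟩
  (1ℚ ℚ.- head q) ℚ.* (x′ ℚ.- x) ℚ.+ head q ℚ.* (y′ ℚ.- y)
    ≡⟨ cong₂ (λ v w → (1ℚ ℚ.- head q) ℚ.* v ℚ.+ head q ℚ.* w)
         (mean-update (tail q) (F ∘ (inside Vec.∷_)) u p) (mean-update (tail q) (F ∘ (outside Vec.∷_)) u p) ⟩
  (1ℚ ℚ.- head q) ℚ.* (d ℚ.* v) ℚ.+ head q ℚ.* (d ℚ.* w)
    ≡⟨ solve 4 (λ q d v w → (con 1ℚ :- q) :* (d :* v) :+ q :* (d :* w)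
         := d :* ((con 1ℚ :- q) :* v :+ q :* w)) refl (head q) d v w ⟩
  d ℚ.* mean q (influenceℚ F (suc u)) ∎
  where
  open ≡-Reasoning
  q′ = updateAt (tail q) u (λ _ → p)
  x  = mean (tail q) (F ∘ (inside Vec.∷_))
  y  = mean (tail q) (F ∘ (outside Vec.∷_))
  x′ = mean q′ (F ∘ (inside Vec.∷_))
  y′ = mean q′ (F ∘ (outside Vec.∷_))
  d  = q (suc u) ℚ.- p
  v  = mean (tail q) (influenceℚ (F ∘ (inside Vec.∷_)) u)
  w  = mean (tail q) (influenceℚ (F ∘ (outside Vec.∷_)) u)

-- Adding u changes the set only when u is absent, which has probability q u.
mean-gain : ∀ {n} (q : Vector ℚ n) F u → q u ℚ.* mean q (influenceℚ F u) ≡ mean q (gainℚ F u)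
mean-gain {ℕ.suc n} q F zero = begin
  head q ℚ.* ((1ℚ ℚ.- head q) ℚ.* z ℚ.+ head q ℚ.* z)
    ≡⟨ solve 3 (λ q x z → q :* ((con 1ℚ :- q) :* z :+ q :* z)
         := (con 1ℚ :- q) :* (x :- x) :+ q :* z) refl (head q) x z ⟩
  (1ℚ ℚ.- head q) ℚ.* (x ℚ.- x) ℚ.+ head q ℚ.* z
    ≡⟨ cong (λ v → (1ℚ ℚ.- head q) ℚ.* v ℚ.+ head q ℚ.* z)
         (mean-- (tail q) (F ∘ (inside Vec.∷_)) (F ∘ (inside Vec.∷_))) ⟨
  mean q (gainℚ F zero) ∎
  where
  open ≡-Reasoning
  x = mean (tail q) (F ∘ (inside Vec.∷_))
  z = mean (tail q) (λ S → F (inside Vec.∷ S) ℚ.- F (outside Vec.∷ S))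
mean-gain {ℕ.suc n} q F (suc u) = begin
  q (suc u) ℚ.* ((1ℚ ℚ.- head q) ℚ.* v ℚ.+ head q ℚ.* w)
    ≡⟨ solve 4 (λ p q v w → p :* ((con 1ℚ :- q) :* v :+ q :* w)
         := (con 1ℚ :- q) :* (p :* v) :+ q :* (p :* w)) refl (q (suc u)) (head q) v w ⟩
  (1ℚ ℚ.- head q) ℚ.* (q (suc u) ℚ.* v) ℚ.+ head q ℚ.* (q (suc u) ℚ.* w)
    ≡⟨ cong₂ (λ v w → (1ℚ ℚ.- head q) ℚ.* v ℚ.+ head q ℚ.* w)
         (mean-gain (tail q) (F ∘ (inside Vec.∷_)) u) (mean-gain (tail q) (F ∘ (outside Vec.∷_)) u) ⟩
  mean q (gainℚ F (suc u)) ∎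
  where
  open ≡-Reasoning
  v = mean (tail q) (influenceℚ (F ∘ (inside Vec.∷_)) u)
  w = mean (tail q) (influenceℚ (F ∘ (outside Vec.∷_)) u)

-- The sum of the rationals g x over the list xs.
∑ℚ : List X → (X → ℚ) → ℚ
∑ℚ xs g = foldr ℚ._+_ 0ℚ (map g xs)

∑ℚ-cong : ∀ (xs : List X) {g h : X → ℚ} → (∀ x → g x ≡ h x) → ∑ℚ xs g ≡ ∑ℚ xs h
∑ℚ-cong xs g≗h = cong (foldr ℚ._+_ 0ℚ) (map-cong g≗h xs)

∑ℚ-++ : ∀ (xs ys : List X) g → ∑ℚ (xs ++ ys) g ≡ ∑ℚ xs g ℚ.+ ∑ℚ ys g
∑ℚ-++ []       ys g = sym (ℚ.+-identityˡ (∑ℚ ys g))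
∑ℚ-++ (x ∷ xs) ys g = trans (cong (g x ℚ.+_) (∑ℚ-++ xs ys g)) (sym (ℚ.+-assoc (g x) (∑ℚ xs g) (∑ℚ ys g)))

∑ℚ-*ˡ : ∀ c (xs : List X) g → ∑ℚ xs (λ x → c ℚ.* g x) ≡ c ℚ.* ∑ℚ xs g
∑ℚ-*ˡ c []       g = sym (ℚ.*-zeroʳ c)
∑ℚ-*ˡ c (x ∷ xs) g = trans (cong (c ℚ.* g x ℚ.+_) (∑ℚ-*ˡ c xs g)) (sym (ℚ.*-distribˡ-+ c (g x) (∑ℚ xs g)))

-- The probability that R, as in mean, equals S.
weight : ∀ {n} → Vector ℚ n → Subset n → ℚ
weight q S = Vector.foldr ℚ._*_ 1ℚ (λ u → if Vec.lookup S u then 1ℚ ℚ.- q u else q u)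

∑ℚ-weight : ∀ {n} (q : Vector ℚ n) F → ∑ℚ (subsets n) (λ S → weight q S ℚ.* F S) ≡ mean q F
∑ℚ-weight {ℕ.zero}  q F = trans (ℚ.+-identityʳ (1ℚ ℚ.* F Vec.[])) (ℚ.*-identityˡ (F Vec.[]))
∑ℚ-weight {ℕ.suc n} q F = trans
  (∑ℚ-++ (map (inside Vec.∷_) (subsets n)) (map (outside Vec.∷_) (subsets n)) (λ S → weight q S ℚ.* F S))
  (cong₂ ℚ._+_ (branch inside) (branch outside))
  where
  open ≡-Reasoning
  p : Side → ℚ
  p s = if s then 1ℚ ℚ.- head q else head q
  branch : ∀ s → ∑ℚ (map (s Vec.∷_) (subsets n)) (λ S → weight q S ℚ.* F S) ≡ p s ℚ.* mean (tail q) (F ∘ (s Vec.∷_))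
  branch s = begin
    ∑ℚ (map (s Vec.∷_) (subsets n)) (λ S → weight q S ℚ.* F S)
      ≡⟨ cong (foldr ℚ._+_ 0ℚ) (map-∘ (subsets n)) ⟨
    ∑ℚ (subsets n) (λ S → p s ℚ.* weight (tail q) S ℚ.* F (s Vec.∷ S))
      ≡⟨ ∑ℚ-cong (subsets n) (λ S → ℚ.*-assoc (p s) (weight (tail q) S) (F (s Vec.∷ S))) ⟩
    ∑ℚ (subsets n) (λ S → p s ℚ.* (weight (tail q) S ℚ.* F (s Vec.∷ S)))
      ≡⟨ ∑ℚ-*ˡ (p s) (subsets n) (λ S → weight (tail q) S ℚ.* F (s Vec.∷ S)) ⟩
    p s ℚ.* ∑ℚ (subsets n) (λ S → weight (tail q) S ℚ.* F (s Vec.∷ S))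
      ≡⟨ cong (p s ℚ.*_) (∑ℚ-weight (tail q) (F ∘ (s Vec.∷_))) ⟩
    p s ℚ.* mean (tail q) (F ∘ (s Vec.∷_)) ∎

mean-∑ : ∀ {n} (q : Vector ℚ n) (xs : List X) (G : X → Subset n → ℚ) →
  mean q (λ S → ∑ℚ xs (λ x → G x S)) ≡ ∑ℚ xs (λ x → mean q (G x))
mean-∑ q []       G = mean-const q 0ℚ
mean-∑ q (x ∷ xs) G = trans (mean-+ q (G x) (λ S → ∑ℚ xs (λ x → G x S)))
  (cong (mean q (G x) ℚ.+_) (mean-∑ q xs G))

-- The expectation over R(A)

seq-∑ : ∀ (xs : List X) g k → seq (∑ xs g) k ≡ ∑ℚ xs (λ x → seq (g x) k)
seq-∑ []       g k = refl
seq-∑ (x ∷ xs) g k = cong (seq (g x) k ℚ.+_) (seq-∑ xs g k)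

seq-∏ : ∀ {n} (v : Vector ℝ n) k → seq (∏ v) k ≡ Vector.foldr ℚ._*_ 1ℚ (λ u → seq (v u) k)
seq-∏ {ℕ.zero}  v k = refl
seq-∏ {ℕ.suc n} v k = cong (seq (head v) k ℚ.*_) (seq-∏ (tail v) k)

∏ℚ-cong : ∀ {n} {v w : Vector ℚ n} → (∀ u → v u ≡ w u) → Vector.foldr ℚ._*_ 1ℚ v ≡ Vector.foldr ℚ._*_ 1ℚ w
∏ℚ-cong {ℕ.zero}  v≗w = refl
∏ℚ-cong {ℕ.suc n} v≗w = cong₂ ℚ._*_ (v≗w zero) (∏ℚ-cong (v≗w ∘ suc))

-- The k-th approximants of the probabilities that R(A) omits u.
omission : ∀ {n} → Vector ℝ n → ℕ → Vector ℚ n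
omission A k u = seq (exp (- A u)) k

seq-if : ∀ b x y k → seq (if b then x else y) k ≡ (if b then seq x k else seq y k)
seq-if b x y k = if-float (λ z → seq z k) b

seq-ℙ : ∀ {n} (A : Vector ℝ n) S k → seq ℙ[R A ≡ S ] k ≡ weight (omission A k) S
seq-ℙ A S k = trans (seq-∏ (λ u → if Vec.lookup S u then 1ℝ - exp (- A u) else exp (- A u)) k)
  (∏ℚ-cong λ u → seq-if (Vec.lookup S u) (1ℝ - exp (- A u)) (exp (- A u)) k)

seq-𝔼 : ∀ {n} (f : Subset n → ℝ) A k → seq (𝔼 f A) k ≡ mean (omission A k) (λ S → seq (f S) k)
seq-𝔼 {n} f A k = trans (seq-∑ (subsets n) (λ S → ℙ[R A ≡ S ] * f S) k)
  (trans (∑ℚ-cong (subsets n) (λ S → cong (ℚ._* seq (f S) k) (seq-ℙ A S k)))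
    (∑ℚ-weight (omission A k) (λ S → seq (f S) k)))

omission-⊕ : ∀ {n} (A : Vector ℝ n) u t k v →
  omission (A ⊕[ u , t ]) k v ≡ updateAt (omission A k) u (λ _ → seq (exp (- (A u + t))) k) v
omission-⊕ A zero    t k zero    = refl
omission-⊕ A zero    t k (suc v) = refl
omission-⊕ A (suc u) t k zero    = refl
omission-⊕ A (suc u) t k (suc v) = omission-⊕ (tail A) u t k v

𝔼-const : ∀ {n} c (A : Vector ℝ n) → 𝔼 (λ _ → c) A ≐ c
𝔼-const c A .at k = trans (seq-𝔼 (λ _ → c) A k) (mean-const (omission A k) (seq c k))

𝔼-+ : ∀ {n} (f g : Subset n → ℝ) A → 𝔼 (λ S → f S + g S) A ≐ 𝔼 f A + 𝔼 g A
𝔼-+ f g A .at k = begin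
  seq (𝔼 (λ S → f S + g S) A) k             ≡⟨ seq-𝔼 (λ S → f S + g S) A k ⟩
  mean q (λ S → seq (f S) k ℚ.+ seq (g S) k)  ≡⟨ mean-+ q (λ S → seq (f S) k) (λ S → seq (g S) k) ⟩
  mean q (λ S → seq (f S) k) ℚ.+ mean q (λ S → seq (g S) k)
                                              ≡⟨ cong₂ ℚ._+_ (seq-𝔼 f A k) (seq-𝔼 g A k) ⟨
  seq (𝔼 f A) k ℚ.+ seq (𝔼 g A) k             ∎
  where
  open ≡-Reasoning
  q = omission A k

𝔼-∑ : ∀ {n} (xs : List X) (g : X → Subset n → ℝ) A →
  𝔼 (λ S → ∑ xs (λ x → g x S)) A ≐ ∑ xs (λ x → 𝔼 (g x) A)
𝔼-∑ xs g A .at k = begin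
  seq (𝔼 (λ S → ∑ xs (λ x → g x S)) A) k            ≡⟨ seq-𝔼 (λ S → ∑ xs (λ x → g x S)) A k ⟩
  mean q (λ S → seq (∑ xs (λ x → g x S)) k)          ≡⟨ mean-cong (λ _ → refl) (λ S → seq-∑ xs (λ x → g x S) k) ⟩
  mean q (λ S → ∑ℚ xs (λ x → seq (g x S) k))         ≡⟨ mean-∑ q xs (λ x S → seq (g x S) k) ⟩
  ∑ℚ xs (λ x → mean q (λ S → seq (g x S) k))         ≡⟨ ∑ℚ-cong xs (λ x → seq-𝔼 (g x) A k) ⟨
  ∑ℚ xs (λ x → seq (𝔼 (g x) A) k)                    ≡⟨ seq-∑ xs (λ x → 𝔼 (g x) A) k ⟨
  seq (∑ xs (λ x → 𝔼 (g x) A)) k                     ∎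
  where
  open ≡-Reasoning
  q = omission A k

-- Marginal values

-- As influenceℚ and gainℚ, for a real set function.
influence gain : ∀ {n} → (Subset n → ℝ) → Fin n → Subset n → ℝ
influence f u S = f (S [ u ]≔ inside) - f (S [ u ]≔ outside)
gain      f u S = f (S [ u ]≔ inside) - f S

𝔼-increment : ∀ {n} (f : Subset n → ℝ) A u t →
  𝔼 f (A ⊕[ u , t ]) - 𝔼 f A ≐ (exp (- A u) - exp (- (A u + t))) * 𝔼 (influence f u) A
𝔼-increment f A u t .at k = begin
  seq (𝔼 f (A ⊕[ u , t ])) k ℚ.- seq (𝔼 f A) k
    ≡⟨ cong₂ ℚ._-_ (trans (seq-𝔼 f (A ⊕[ u , t ]) k) (mean-cong (omission-⊕ A u t k) λ _ → refl)) (seq-𝔼 f A k) ⟩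
  mean (updateAt q u (λ _ → p)) F ℚ.- mean q F
    ≡⟨ mean-update q F u p ⟩
  (q u ℚ.- p) ℚ.* mean q (influenceℚ F u)
    ≡⟨ cong ((q u ℚ.- p) ℚ.*_) (seq-𝔼 (influence f u) A k) ⟨
  (q u ℚ.- p) ℚ.* seq (𝔼 (influence f u) A) k ∎
  where
  open ≡-Reasoning
  q = omission A k
  p = seq (exp (- (A u + t))) k
  F = λ S → seq (f S) k

𝔼-gain : ∀ {n} (f : Subset n → ℝ) A u →
  𝔼 (gain f u) A ≐ exp (- A u) * 𝔼 (influence f u) A
𝔼-gain f A u .at k = begin
  seq (𝔼 (gain f u) A) k                    ≡⟨ seq-𝔼 (gain f u) A k ⟩
  mean q (gainℚ F u)                         ≡⟨ mean-gain q F u ⟨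
  q u ℚ.* mean q (influenceℚ F u)            ≡⟨ cong (q u ℚ.*_) (seq-𝔼 (influence f u) A k) ⟨
  q u ℚ.* seq (𝔼 (influence f u) A) k        ∎
  where
  open ≡-Reasoning
  q = omission A k
  F = λ S → seq (f S) k

-- The marginal value of u at A in closed form.
marginal : ∀ {n} → (Subset n → ℝ) → Vector ℝ n → Fin n → ℝ
marginal f A u = exp (- A u) * 𝔼 (influence f u) A

isMarginal : ∀ {n} (f : Subset n → ℝ) A u → IsMarginal f A u (marginal f A u)
isMarginal f A u =
  let c , 0≤c , bound = exp-increment (A u) (𝔼 (influence f u) A)
  in quotient-limit (λ t → 𝔼 f (A ⊕[ u , t ]) - 𝔼 f A) (marginal f A u) c 0≤c λ t 0<t t<1 → begin
       ∣ 𝔼 f (A ⊕[ u , t ]) - 𝔼 f A - marginal f A u * t ∣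
         ≈⟨ termwise (λ k → cong (λ x → ℚ.∣ x ℚ.- seq (marginal f A u * t) k ∣) (at (𝔼-increment f A u t) k)) ⟩
       ∣ (exp (- A u) - exp (- (A u + t))) * 𝔼 (influence f u) A - marginal f A u * t ∣
         ≲⟨ bound t 0<t t<1 ⟩
       fromℚ c * (t * t) ∎
  where open ≤-Reasoning

-- Monotonicity of the expectation

∑-mono : ∀ (xs : List X) (g h : X → ℝ) → (∀ x → g x ≤ h x) → ∑ xs g ≤ ∑ xs h
∑-mono []       g h g≤h = ≤-refl 0ℝ
∑-mono (x ∷ xs) g h g≤h = +-mono-≤ (g x) (h x) (∑ xs g) (∑ xs h) (g≤h x) (∑-mono xs g h g≤h)

∑-cong : ∀ (xs : List X) {g h : X → ℝ} → (∀ x → g x ≐ h x) → ∀ k → seq (∑ xs g) k ≡ seq (∑ xs h) k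
∑-cong []       g≐h k = refl
∑-cong (x ∷ xs) g≐h k = cong₂ ℚ._+_ (at (g≐h x) k) (∑-cong xs g≐h k)

0≤∏ : ∀ {n} (v : Vector ℝ n) → (∀ u → 0ℝ ≤ v u) → 0ℝ ≤ ∏ v
0≤∏ {ℕ.zero}  v 0≤v ε 0<ε = 0 , λ _ _ → 0≤+ 0≤1 (ℚ.<⇒≤ 0<ε)
0≤∏ {ℕ.suc n} v 0≤v = 0≤x*y (head v) (∏ (tail v)) (0≤v zero) (0≤∏ (tail v) (0≤v ∘ suc))

0≤1-exp[-x] : ∀ x → 0ℝ ≤ x → 0ℝ ≤ 1ℝ - exp (- x)
0≤1-exp[-x] x 0≤x = x≤y⇒0≤y-x (exp (- x)) 1ℝ (exp[-x]≤1 x 0≤x)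

0≤ℙ : ∀ {n} (A : Vector ℝ n) → (∀ u → 0ℝ ≤ A u) → ∀ S → 0ℝ ≤ ℙ[R A ≡ S ]
0≤ℙ A 0≤A S = 0≤∏ (λ u → if Vec.lookup S u then 1ℝ - exp (- A u) else exp (- A u))
  λ u → 0≤if (Vec.lookup S u) (0≤1-exp[-x] (A u) (0≤A u)) (0≤exp (- A u))
  where
  0≤if : ∀ b {x y} → 0ℝ ≤ x → 0ℝ ≤ y → 0ℝ ≤ (if b then x else y)
  0≤if inside  0≤x 0≤y = 0≤x
  0≤if outside 0≤x 0≤y = 0≤y

𝔼-mono : ∀ {n} (f g : Subset n → ℝ) A → (∀ u → 0ℝ ≤ A u) → (∀ S → f S ≤ g S) → 𝔼 f A ≤ 𝔼 g A
𝔼-mono f g A 0≤A f≤g = ∑-mono (subsets _) (λ S → ℙ[R A ≡ S ] * f S) (λ S → ℙ[R A ≡ S ] * g S)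
  λ S → *-monoʳ-≤ ℙ[R A ≡ S ] (f S) (g S) (0≤ℙ A 0≤A S) (f≤g S)

-- The inequality for a fixed set

module _ {n} {S : Subset n} (v : Fin n) where

  -- S [ v ]≔ inside is the set S with v added.
  v∈S+v : v ∈ S [ v ]≔ inside
  v∈S+v = []≔-updates S v

  S⊆S+v : S ⊆ S [ v ]≔ inside
  S⊆S+v {w} w∈S with w ≟ v
  ... | yes refl = v∈S+v
  ... | no  w≢v  = []≔-minimal S w v w≢v w∈S

  ∈S+v⁻ : ∀ {w} → w ≢ v → w ∈ S [ v ]≔ inside → w ∈ S
  ∈S+v⁻ {w} w≢v w∈ = lookup⇒[]= w S
    (trans (sym (lookup∘update′ w≢v S inside)) ([]=⇒lookup w∈))

-- S together with the elements of xs.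
adjoin : ∀ {n} → Subset n → List (Fin n) → Subset n
adjoin = foldr (λ v T → T [ v ]≔ inside)

⊆-adjoin : ∀ {n} (S : Subset n) xs → S ⊆ adjoin S xs
⊆-adjoin S []       w∈S = w∈S
⊆-adjoin S (v ∷ xs) w∈S = S⊆S+v v (⊆-adjoin S xs w∈S)

∈-adjoin : ∀ {n} (S : Subset n) xs {v} → v ∈ˡ xs → v ∈ adjoin S xs
∈-adjoin S (x ∷ xs) (here refl)  = v∈S+v x
∈-adjoin S (x ∷ xs) (there v∈xs) = S⊆S+v x (∈-adjoin S xs v∈xs)

module _ {n} {f : Subset n → ℝ} (mono : Monotone f) (submod : Submodular f) where

  open ≤-Reasoning

  -- Submodularity for T and S with v: their union contains T with v, and
  -- their intersection contains S.
  diminishing-gain : ∀ {S T} v → S ⊆ T →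
    f (T [ v ]≔ inside) + f S ≤ f T + f (S [ v ]≔ inside)
  diminishing-gain {S} {T} v S⊆T = begin
    f T+v + f S                ≲⟨ +-mono-≤ (f T+v) (f (T ∪ S+v)) (f S) (f (T ∩ S+v))
                                    (mono T+v (T ∪ S+v) T+v⊆) (mono S (T ∩ S+v) S⊆) ⟩
    f (T ∪ S+v) + f (T ∩ S+v)  ≲⟨ submod T S+v ⟩
    f T + f S+v                ∎
    where
    T+v = T [ v ]≔ inside
    S+v = S [ v ]≔ inside
    T+v⊆ : T+v ⊆ T ∪ S+v
    T+v⊆ {w} w∈ with w ≟ v
    ... | yes refl = x∈p∪q⁺ (inj₂ (v∈S+v v))
    ... | no  w≢v  = x∈p∪q⁺ (inj₁ (∈S+v⁻ v w≢v w∈))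
    S⊆ : S ⊆ T ∩ S+v
    S⊆ w∈S = x∈p∩q⁺ (S⊆T w∈S , S⊆S+v v w∈S)

  adjoin-≤ : ∀ S xs → f (adjoin S xs) ≤ f S + ∑ xs (λ v → gain f v S)
  adjoin-≤ S []       = ≐⇒≤ {f S} {f S + 0ℝ} (termwise λ k → sym (ℚ.+-identityʳ (seq (f S) k)))
  adjoin-≤ S (v ∷ xs) = +-cancelʳ-≤ (f (U [ v ]≔ inside)) (f S + (gain f v S + s)) (f S) (begin
    f (U [ v ]≔ inside) + f S                ≲⟨ diminishing-gain v (⊆-adjoin S xs) ⟩
    f U + f (S [ v ]≔ inside)                ≲⟨ +-mono-≤ (f U) (f S + s) (f (S [ v ]≔ inside)) (f (S [ v ]≔ inside))
                                                  (adjoin-≤ S xs) (≤-refl (f (S [ v ]≔ inside))) ⟩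
    (f S + s) + f (S [ v ]≔ inside)          ≈⟨ regroup ⟩
    (f S + (gain f v S + s)) + f S           ∎)
    where
    U = adjoin S xs
    s = ∑ xs (λ v → gain f v S)
    regroup : (f S + s) + f (S [ v ]≔ inside) ≐ (f S + (gain f v S + s)) + f S
    regroup .at k = solve 3 (λ x s y → x :+ s :+ y := x :+ (y :- x :+ s) :+ x) refl
      (seq (f S) k) (seq s k) (seq (f (S [ v ]≔ inside)) k)

  ≤-sum-of-gains : ∀ O S → f O ≤ f S + ∑ (elements O) (λ v → gain f v S)
  ≤-sum-of-gains O S = begin
    f O                                         ≲⟨ mono O (adjoin S (elements O)) O⊆ ⟩
    f (adjoin S (elements O))                   ≲⟨ adjoin-≤ S (elements O) ⟩
    f S + ∑ (elements O) (λ v → gain f v S)     ∎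
    where
    O⊆ : O ⊆ adjoin S (elements O)
    O⊆ {v} v∈O = ∈-adjoin S (elements O) (∈-filter⁺ (_∈? O) (∈-allFin v) v∈O)

lemma4p5 : (n : ℕ) (f : Subset n → ℝ) →
    (∀ S → 0ℝ ≤ f S) → Monotone f → Submodular f →
    (O : Subset n) (A : Vector ℝ n) → (∀ u → 0ℝ ≤ A u) →
    Σ[ m ∈ (Fin n → ℝ) ]
    ((∀ v → IsMarginal f A v (m v)) ×
    (f O ≤ 𝔼 f A + ∑ (elements O) m))
lemma4p5 n f _ mono submod O A 0≤A = marginal f A , isMarginal f A , (begin
  f O
    ≈⟨ 𝔼-const (f O) A ⟨
  𝔼 (λ _ → f O) A
    ≲⟨ 𝔼-mono (λ _ → f O) (λ S → f S + ∑ (elements O) (λ v → gain f v S)) A 0≤A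
         (≤-sum-of-gains {f = f} mono submod O) ⟩
  𝔼 (λ S → f S + ∑ (elements O) (λ v → gain f v S)) A
    ≈⟨ 𝔼-+ f (λ S → ∑ (elements O) (λ v → gain f v S)) A ⟩
  𝔼 f A + 𝔼 (λ S → ∑ (elements O) (λ v → gain f v S)) A
    ≈⟨ termwise (λ k → cong (seq (𝔼 f A) k ℚ.+_)
         (trans (at (𝔼-∑ (elements O) (gain f) A) k) (∑-cong (elements O) (𝔼-gain f A) k))) ⟩
  𝔼 f A + ∑ (elements O) (marginal f A) ∎)
  where open ≤-Reasoning
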